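{- For any weighted digraph $\Gamma$ with Kirchhoff matrix $L$ and out forest dimension $v$, and any $k=0,\dots,n-v$, $$Q_k=\sum_{i=0}^{k}\sigma_{k-i}\,(-L)^{i},$$ where $Q_k$ is the matrix of out forests of $\Gamma$ with $k$ arcs and $\sigma_j$ is the total weight of all out forests of $\Gamma$ with $j$ arcs.
   Context: $\Gamma$ is a weighted digraph without loops with vertex set $\{1,\dots,n\}$, $n>1$; all arcs have strictly positive real weights; $\varepsilon_{ij}$ denotes the weight of the arc from $i$ to $j$, with $\varepsilon_{ij}=0$ if and only if there is no such arc. The Kirchhoff matrix $L=(\ell_{ij})$ is the $n\times n$ matrix with $\ell_{ij}=-\varepsilon_{ji}$ for $j\ne i$ and $\ell_{ii}=-\sum_{k\ne i}\ell_{ik}$. A diverging forest is a digraph without (directed) circuits in which every vertex has indegree at most 1; its weak components are diverging trees, each having a unique vertex of indegree 0 (its root) from which all vertices of the tree are reachable; one says the tree diverges from its root. An out forest of $\Gamma$ is a spanning subgraph of $\Gamma$ that is a diverging forest. The weight of a subgraph is the product of the weights of its arcs (1 if it has no arcs); the weight $\varepsilon(\mathcal G)$ of a set $\mathcal G$ of subgraphs is the sum of the weights of its elements (0 for the empty set). The out forest dimension $v$ is the minimum number of weak components of an out forest of $\Gamma$, so the maximum number of arcs of an out forest is $n-v$. $\mathcal F_k$ is the set of out forests of $\Gamma$ with $k$ arcs; $\mathcal F_k^{j\to i}$ is the set of those in which $i$ belongs to a tree diverging from $j$ (i.e. with root $j$). $\sigma_k=\varepsilon(\mathcal F_k)$,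 and $Q_k=(q^k_{ij})$ with $q^k_{ij}=\varepsilon(\mathcal F_k^{j\to i})$, $i,j=1,\dots,n$. -}

module Defs where

open import Algebra.Apartness.Bundles using (HeytingField)
open import Algebra.Bundles using (CommutativeRing)
import Algebra.Properties.Monoid.Sum as Sum
open import Data.Bool.Base using (true; false; if_then_else_)
open import Data.Fin.Base using (Fin)
open import Data.Fin.Properties using (_≟_; all?; any?)
open import Data.Fin.Subset using (Subset; _∈_)
open import Data.Fin.Subset.Properties using (_∈?_)
open import Data.List.Base using (List; []; _∷_; map; foldr; filter; length; allFin; cartesianProduct; cartesianProductWith; deduplicate)
open import Data.List.Membership.Propositional using () renaming (_∈_ to _∈ˡ_)
open import Data.List.Membership.Propositional.Properties using (∈-allFin)
open import Data.List.Relation.Unary.Any using (here; there)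
open import Data.Nat.Base using (ℕ; zero; suc; _≤_)
import Data.Nat.Properties as ℕ
open import Data.Product.Base using (_×_; _,_; ∃-syntax; uncurry)
open import Data.Sum.Base using (_⊎_; inj₁; inj₂)
open import Data.Vec.Base using (Vec; []; _∷_; lookup)
open import Function.Base using (_∘_)
open import Function.Bundles using (_⇔_)
open import Level using (Level; _⊔_) renaming (suc to lsuc)
open import Relation.Binary.Construct.Closure.Equivalence using (EqClosure)
open import Relation.Binary.Construct.Closure.ReflexiveTransitive using (Star; ε; _◅_; _◅◅_)
open import Relation.Binary.Construct.Closure.Symmetric using (SymClosure; fwd; bwd)
open import Relation.Binary.Construct.Closure.Transitive using (TransClosure; [_]; _∷_)
open import Relation.Binary.Core using (Rel)
open import Relation.Binary.Definitions using (Decidable)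
open import Relation.Binary.PropositionalEquality.Core using (_≡_; refl)
open import Relation.Binary.Structures using (IsStrictPartialOrder)
open import Relation.Nullary.Decidable using (Dec; yes; no; does; map′; ¬?; _×-dec_; _⊎-dec_; _→-dec_)
open import Relation.Nullary.Negation using (¬_)

private
  variable
    c ℓ₁ ℓ₂ ℓ₃ : Level
    n : ℕ

-- Weights live in an arbitrary ordered field, the intended case being ℝ.  The
-- order is not assumed decidable or total, so that constructive as well as
-- classical reals are models (classically, _#_ is the negation of _≈_).

record OrderedField c ℓ₁ ℓ₂ ℓ₃ : Set (lsuc (c ⊔ ℓ₁ ⊔ ℓ₂ ⊔ ℓ₃)) where
  infix 4 _<_
  field
    heytingField : HeytingField c ℓ₁ ℓ₂

  open HeytingField heytingField public

  field
    _<_                  : Rel Carrier ℓ₃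
    isStrictPartialOrder : IsStrictPartialOrder _≈_ _<_
    #⇔<⊎>                : ∀ {x y} → x # y ⇔ (x < y ⊎ y < x)
    +-monoˡ-<            : ∀ z {x y} → x < y → x + z < y + z
    *-pos                : ∀ {x y} → 0# < x → 0# < y → 0# < x * y

  commutativeRing : CommutativeRing c ℓ₁
  commutativeRing = record { isCommutativeRing = isCommutativeRing }

------------------------------------------------------------------------
-- Decidability of reflexive transitive closures over a finite set

module _ {r} {R : Rel (Fin n) r} (R? : Decidable R) where
  private
    -- Walks all of whose intermediate vertices lie in the given list.
    Via : List (Fin n) → Rel (Fin n) r
    Via []       i j = i ≡ j ⊎ R i j
    Via (v ∷ vs) i j = Via vs i j ⊎ (Via vs i v × Via vs v j)

    via? : ∀ vs → Decidable (Via vs)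
    via? []       i j = (i ≟ j) ⊎-dec R? i j
    via? (v ∷ vs) i j = via? vs i j ⊎-dec (via? vs i v ×-dec via? vs v j)

    base : ∀ vs {i j} → i ≡ j ⊎ R i j → Via vs i j
    base []       p = p
    base (v ∷ vs) p = inj₁ (base vs p)

    concat : ∀ {vs i v j} → v ∈ˡ vs → Via vs i v → Via vs v j → Via vs i j
    concat (here refl) (inj₁ p)       (inj₁ q)       = inj₂ (p , q)
    concat (here refl) (inj₁ p)       (inj₂ (_ , q)) = inj₂ (p , q)
    concat (here refl) (inj₂ (p , _)) (inj₁ q)       = inj₂ (p , q)
    concat (here refl) (inj₂ (p , _)) (inj₂ (_ , q)) = inj₂ (p , q)
    concat (there m) (inj₁ p)       (inj₁ q)       = inj₁ (concat m p q)
    concat (there m) (inj₁ p)       (inj₂ (q , s)) = inj₂ (concat m p q , s)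
    concat (there m) (inj₂ (p , q)) (inj₁ s)       = inj₂ (p , concat m q s)
    concat (there m) (inj₂ (p , _)) (inj₂ (_ , s)) = inj₂ (p , s)

    sound : ∀ vs {i j} → Via vs i j → Star R i j
    sound []       (inj₁ refl)    = ε
    sound []       (inj₂ r)       = r ◅ ε
    sound (v ∷ vs) (inj₁ p)       = sound vs p
    sound (v ∷ vs) (inj₂ (p , q)) = sound vs p ◅◅ sound vs q

    complete : ∀ {i j} → Star R i j → Via (allFin n) i j
    complete ε        = base _ (inj₁ refl)
    complete (r ◅ rs) = concat (∈-allFin _) (base _ (inj₂ r)) (complete rs)

  star? : Decidable (Star R)
  star? i j = map′ (sound _) complete (via? (allFin n) i j)

  trans? : Decidable (TransClosure R)
  trans? i j = map′ to from (any? λ k → R? i k ×-dec star? k j)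
    where
    snoc : ∀ {i k j} → R i k → Star R k j → TransClosure R i j
    snoc r ε        = [ r ]
    snoc r (s ◅ ss) = r ∷ snoc s ss

    to : ∃[ k ] (R i k × Star R k j) → TransClosure R i j
    to (_ , r , rs) = snoc r rs

    star : ∀ {i j} → TransClosure R i j → Star R i j
    star [ r ]    = r ◅ ε
    star (r ∷ rs) = r ◅ star rs

    from : TransClosure R i j → ∃[ k ] (R i k × Star R k j)
    from [ r ]    = _ , r , ε
    from (r ∷ rs) = _ , r , star rs

------------------------------------------------------------------------
-- Digraphs on the vertex set Fin n

-- The i-th entry is the set of heads of the arcs leaving i.
Digraph : ℕ → Set
Digraph n = Vec (Subset n) n

Arc : Digraph n → Rel (Fin n) _
Arc H i j = j ∈ lookup H i

arc? : (H : Digraph n) → Decidable (Arc H)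
arc? H i j = j ∈? lookup H i

allVecs : ∀ {a} {A : Set a} → List A → ∀ m → List (Vec A m)
allVecs xs zero    = [] ∷ []
allVecs xs (suc m) = cartesianProductWith _∷_ xs (allVecs xs m)

allDigraphs : ∀ n → List (Digraph n)
allDigraphs n = allVecs (allVecs (true ∷ false ∷ []) n) n

arcs : Digraph n → List (Fin n × Fin n)
arcs H = filter (uncurry (arc? H)) (cartesianProduct (allFin _) (allFin _))

indegree : Digraph n → Fin n → ℕ
indegree H j = length (filter (λ i → arc? H i j) (allFin _))

_⊆ᴳ_ : Digraph n → Digraph n → Set
H ⊆ᴳ G = ∀ i j → Arc H i j → Arc G i j

-- A closed walk of positive length exists exactly when a circuit does.
Acyclic : Digraph n → Set
Acyclic H = ∀ i → ¬ TransClosure (Arc H) i i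

IsDivergingForest : Digraph n → Set
IsDivergingForest H = Acyclic H × (∀ j → indegree H j ≤ 1)

IsOutForest : Digraph n → Digraph n → Set
IsOutForest G H = H ⊆ᴳ G × IsDivergingForest H

isOutForest? : (G H : Digraph n) → Dec (IsOutForest G H)
isOutForest? G H =
  all? (λ i → all? λ j → arc? H i j →-dec arc? G i j)
  ×-dec all? (λ i → ¬? (trans? (arc? H) i i))
  ×-dec all? (λ j → indegree H j ℕ.≤? 1)

WeaklyConnected : Digraph n → Rel (Fin n) _
WeaklyConnected H = EqClosure (Arc H)

weaklyConnected? : (H : Digraph n) → Decidable (WeaklyConnected H)
weaklyConnected? H = star? λ i j →
  map′ (λ { (inj₁ a) → fwd a ; (inj₂ a) → bwd a })
       (λ { (fwd a) → inj₁ a ; (bwd a) → inj₂ a })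
       (arc? H i j ⊎-dec arc? H j i)

-- One vertex is kept from each weak component.
#components : Digraph n → ℕ
#components H = length (deduplicate (weaklyConnected? H) (allFin _))

-- In a diverging forest the weak components are the trees, and the root of a
-- tree is its vertex of indegree 0: here i belongs to the tree with root j.
InTreeFrom : Digraph n → Rel (Fin n) _
InTreeFrom H j i = indegree H j ≡ 0 × WeaklyConnected H j i

inTreeFrom? : (H : Digraph n) → Decidable (InTreeFrom H)
inTreeFrom? H j i = (indegree H j ℕ.≟ 0) ×-dec weaklyConnected? H j i

record IsOutForestDimension (G : Digraph n) (v : ℕ) : Set where
  field
    attained : ∃[ H ] (IsOutForest G H × #components H ≡ v)
    minimal  : ∀ H → IsOutForest G H → v ≤ #components H

outForests : Digraph n → ℕ → List (Digraph n)
outForests G k =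
  filter (λ H → isOutForest? G H ×-dec (length (arcs H) ℕ.≟ k)) (allDigraphs _)

outForestsFromTo : Digraph n → ℕ → Fin n → Fin n → List (Digraph n)
outForestsFromTo G k j i = filter (λ H → inTreeFrom? H j i) (outForests G k)

------------------------------------------------------------------------
-- Square matrices

module Matrices (R : CommutativeRing c ℓ₁) where
  open CommutativeRing R
  open Sum +-monoid public using (sum-syntax; sum⁺-syntax)

  Matrix : ℕ → Set c
  Matrix n = Fin n → Fin n → Carrier

  infix  8 -ᴹ_
  infixl 7 _*ᴹ_
  infixr 9 _^ᴹ_

  1ᴹ : Matrix n
  1ᴹ i j = if does (i ≟ j) then 1# else 0#

  -ᴹ_ : Matrix n → Matrix n
  (-ᴹ A) i j = - A i j

  _*ᴹ_ : Matrix n → Matrix n → Matrix n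
  _*ᴹ_ {n} A B i j = ∑[ m < n ] (A i m * B m j)

  _^ᴹ_ : Matrix n → ℕ → Matrix n
  A ^ᴹ zero  = 1ᴹ
  A ^ᴹ suc m = A *ᴹ (A ^ᴹ m)

------------------------------------------------------------------------
-- Weighted digraphs

record WeightedDigraph (K : OrderedField c ℓ₁ ℓ₂ ℓ₃) (n : ℕ)
       : Set (c ⊔ ℓ₁ ⊔ ℓ₃) where
  open OrderedField K using (Carrier; _≈_; _<_; 0#)
  field
    graph    : Digraph n
    loopless : ∀ i → ¬ Arc graph i i
    weight   : Fin n → Fin n → Carrier
    positive : ∀ {i j} → Arc graph i j → 0# < weight i j
    no-arc   : ∀ {i j} → ¬ Arc graph i j → weight i j ≈ 0#

module _ {K : OrderedField c ℓ₁ ℓ₂ ℓ₃} (Γ : WeightedDigraph K n) where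
  open OrderedField K
  open Matrices commutativeRing using (Matrix)
  open WeightedDigraph Γ using (graph; weight)

  kirchhoff : Matrix n
  kirchhoff i j with i ≟ j
  ... | no  _ = - weight j i
  ... | yes _ =
    - foldr _+_ 0# (map (λ k → - weight k i) (filter (λ k → ¬? (k ≟ i)) (allFin n)))

  subgraphWeight : Digraph n → Carrier
  subgraphWeight H = foldr _*_ 1# (map (uncurry weight) (arcs H))

  setWeight : List (Digraph n) → Carrier
  setWeight = foldr _+_ 0# ∘ map subgraphWeight

  σ : ℕ → Carrier
  σ k = setWeight (outForests graph k)

  Q : ℕ → Matrix n
  Q k i j = setWeight (outForestsFromTo graph k j i)

{-# OPTIONS --safe #-}
module Submission where

-- An out forest is a choice of at most one parent for every vertex without
-- cycles.  Fix a vertex i and let T be the tree below i in a forest where i is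
-- a root.  Giving i the parent m keeps the forest acyclic iff m ∉ T, and then
-- every vertex of T gets the root of m, all other roots being unchanged.
-- Summing over the choices for i, with those for the other vertices fixed, gives
--   Q (k+1) i j + (Σ_x ε_xi) Q k i j = δ_ij σ (k+1) + Σ_x ε_xi Q k x j,
-- that is Q (k+1) = σ (k+1) I - L Q k, and the formula follows by induction.

open import Defs
open import Algebra.Bundles using (CommutativeMonoid; CommutativeRing; CommutativeSemiring)
open import Data.Bool.Base using (true; false; if_then_else_)
open import Data.Fin.Base using (Fin; zero; suc; toℕ; punchIn; punchOut)
open import Data.Fin.Properties using (_≟_; all?; any?; punchIn-punchOut)
open import Data.List.Base
  using (List; []; _∷_; _++_; map; foldr; filter; length; allFin; cartesianProductWith;
         tabulate)
open import Data.List.Membership.Propositional using () renaming (_∈_ to _∈ˡ_)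
open import Data.List.Membership.Propositional.Properties
  using (∈-allFin; ∈-filter⁺; ∈-filter⁻; ∈-map⁺; ∈-map⁻; ∈-cartesianProductWith⁺)
open import Data.List.Membership.Propositional.Properties.WithK using (unique∧set⇒bag)
open import Data.List.Properties using (map-tabulate)
open import Data.List.Relation.Binary.BagAndSetEquality using (∼bag⇒↭)
import Data.List.Relation.Binary.Permutation.Propositional as Perm
open Perm using (_↭_)
open import Data.List.Relation.Unary.All using (All; []; _∷_)
open import Data.List.Relation.Unary.AllPairs using ([]; _∷_)
open import Data.List.Relation.Unary.Any using (here; there)
open import Data.List.Relation.Unary.Unique.Propositional using (Unique)
import Data.List.Relation.Unary.Unique.Propositional.Properties as Unique
open import Data.Maybe.Base using (Maybe; just; nothing; maybe)
import Data.Maybe.Properties as Maybe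
open import Data.Nat.Base using (ℕ; zero; suc; _≤_; _<_; _∸_; z≤n; s≤s)
import Data.Nat.Base as ℕ
import Data.Nat.Properties as ℕ
open import Data.Product.Base using (_×_; _,_; proj₂; ∃-syntax; uncurry)
open import Data.Sum.Base using (_⊎_; inj₁; inj₂)
open import Data.Vec.Base using (Vec; []; _∷_; lookup; insertAt)
import Data.Vec.Base as Vec
open import Data.Vec.Properties
  using (∷-injective; lookup∘tabulate; tabulate∘lookup; tabulate-cong; []=⇒lookup; lookup⇒[]=;
         insertAt-lookup; insertAt-punchIn)
open import Function.Base using (_∘_)
open import Function.Bundles using (_⇔_; mk⇔; Equivalence)
open import Level using (Level)
import Relation.Binary.Construct.Closure.ReflexiveTransitive as Closure
open Closure using (Star; _◅_; _◅◅_; reverse) renaming (ε to nil)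
open import Relation.Binary.Construct.Closure.Symmetric using (fwd; bwd)
open import Relation.Binary.Construct.Closure.Transitive using (TransClosure; [_]; _∷_)
open import Relation.Binary.Core using (Rel)
import Relation.Binary.Definitions as B
import Relation.Binary.PropositionalEquality as ≡
open ≡ using (_≡_; _≢_)
open import Relation.Nullary.Decidable
  using (Dec; does; yes; no; ¬?; _×-dec_; _→-dec_; dec-true; dec-false; does-⇔;
         decidable-stable)
open import Relation.Nullary.Negation using (¬_; contradiction)

-- In a digraph given by out-neighbour sets, the arcs into a fixed vertex are scattered over all
-- entries. A parent map gathers them into one entry, so the choices for i arise by inserting an
-- entry into a vector that holds the other choices. Instead of restricting the range of summation,
-- parent maps with a cycle or with a pair outside Γ are kept and contribute 0.
--
-- No bijection between forests is needed. Once the choices at the other vertices are fixed, every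
-- quantity is a polynomial in the weights into i and in indicators read off from the forest with i
-- as a root, and the recurrence becomes an algebraic identity. With the in-weight on the left it
-- has no subtraction and can be proved over any commutative semiring; negatives enter only with L.

private
  variable
    a b : Level
    A B C : Set a
    n : ℕ

-- Finite sums and products over lists

module ListSum {c ℓ} (M : CommutativeMonoid c ℓ) where
  open CommutativeMonoid M
  open import Relation.Binary.Reasoning.Setoid setoid
  open import Algebra.Properties.CommutativeSemigroup commutativeSemigroup using (interchange; x∙yz≈y∙xz)
  open import Algebra.Properties.Monoid.Sum monoid using (sum)

  ⨁ : List A → (A → Carrier) → Carrier
  ⨁ xs f = foldr _∙_ ε (map f xs)

  ⨁-cong : ∀ (xs : List A) {f g : A → Carrier} → (∀ x → f x ≈ g x) → ⨁ xs f ≈ ⨁ xs g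
  ⨁-cong []       f≈g = refl
  ⨁-cong (x ∷ xs) f≈g = ∙-cong (f≈g x) (⨁-cong xs f≈g)

  ⨁-ε : ∀ (xs : List A) → ⨁ xs (λ _ → ε) ≈ ε
  ⨁-ε []       = refl
  ⨁-ε (x ∷ xs) = trans (identityˡ _) (⨁-ε xs)

  ⨁-∙ : ∀ (xs : List A) (f g : A → Carrier) → ⨁ xs (λ x → f x ∙ g x) ≈ ⨁ xs f ∙ ⨁ xs g
  ⨁-∙ []       f g = sym (identityˡ ε)
  ⨁-∙ (x ∷ xs) f g = trans (∙-congˡ (⨁-∙ xs f g)) (interchange _ _ _ _)

  ⨁-swap : ∀ (xs : List A) (ys : List B) (f : A → B → Carrier) →
           ⨁ xs (λ x → ⨁ ys (f x)) ≈ ⨁ ys (λ y → ⨁ xs (λ x → f x y))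
  ⨁-swap []       ys f = sym (⨁-ε ys)
  ⨁-swap (x ∷ xs) ys f = trans (∙-congˡ (⨁-swap xs ys f)) (sym (⨁-∙ ys _ _))

  ⨁-map : ∀ (h : A → B) xs (f : B → Carrier) → ⨁ (map h xs) f ≡ ⨁ xs (f ∘ h)
  ⨁-map h []       f = ≡.refl
  ⨁-map h (x ∷ xs) f = ≡.cong (f (h x) ∙_) (⨁-map h xs f)

  ⨁-++ : ∀ xs ys (f : A → Carrier) → ⨁ (xs ++ ys) f ≈ ⨁ xs f ∙ ⨁ ys f
  ⨁-++ []       ys f = sym (identityˡ _)
  ⨁-++ (x ∷ xs) ys f = trans (∙-congˡ (⨁-++ xs ys f)) (sym (assoc _ _ _))

  ⨁-cartesianProductWith : ∀ (h : A → B → C) xs ys (f : C → Carrier) →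
    ⨁ (cartesianProductWith h xs ys) f ≈ ⨁ xs (λ x → ⨁ ys (λ y → f (h x y)))
  ⨁-cartesianProductWith h []       ys f = refl
  ⨁-cartesianProductWith h (x ∷ xs) ys f = begin
    ⨁ (map (h x) ys ++ cartesianProductWith h xs ys) f
      ≈⟨ ⨁-++ (map (h x) ys) _ f ⟩
    ⨁ (map (h x) ys) f ∙ ⨁ (cartesianProductWith h xs ys) f
      ≈⟨ ∙-cong (reflexive (⨁-map (h x) ys f)) (⨁-cartesianProductWith h xs ys f) ⟩
    ⨁ ys (λ y → f (h x y)) ∙ ⨁ xs (λ x → ⨁ ys (λ y → f (h x y))) ∎

  ⨁-filter : ∀ {P : A → Set b} (P? : ∀ x → Dec (P x)) xs (f : A → Carrier) →
             ⨁ (filter P? xs) f ≈ ⨁ xs (λ x → if does (P? x) then f x else ε)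
  ⨁-filter P? []       f = refl
  ⨁-filter P? (x ∷ xs) f with does (P? x)
  ... | true  = ∙-congˡ (⨁-filter P? xs f)
  ... | false = trans (⨁-filter P? xs f) (sym (identityˡ _))

  ⨁-↭ : ∀ {xs ys : List A} (f : A → Carrier) → xs ↭ ys → ⨁ xs f ≈ ⨁ ys f
  ⨁-↭ f Perm.refl         = refl
  ⨁-↭ f (Perm.prep x q)   = ∙-congˡ (⨁-↭ f q)
  ⨁-↭ f (Perm.swap x y q) = trans (∙-congˡ (∙-congˡ (⨁-↭ f q))) (x∙yz≈y∙xz _ _ _)
  ⨁-↭ f (Perm.trans q r)  = trans (⨁-↭ f q) (⨁-↭ f r)

  ⨁-allFin : ∀ n (f : Fin n → Carrier) → ⨁ (allFin n) f ≡ sum f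
  ⨁-allFin n f = ≡.trans (≡.cong (foldr _∙_ ε) (map-tabulate (λ i → i) f)) (go n f)
    where
    go : ∀ n (f : Fin n → Carrier) → foldr _∙_ ε (tabulate f) ≡ sum f
    go zero    f = ≡.refl
    go (suc n) f = ≡.cong (f zero ∙_) (go n (f ∘ suc))

  -- Since `f` is neutral at `i`, changing that entry contributes exactly `g i`. Grafting uses this
  -- twice: a root adds no arc to the count and no factor to the weight.
  ⨁-update : ∀ {n} (i : Fin n) (f g : Fin n → Carrier) → f i ≈ ε → (∀ j → j ≢ i → g j ≈ f j) →
             ⨁ (allFin n) g ≈ g i ∙ ⨁ (allFin n) f
  ⨁-update {n} i f g fi≈ε g≈f = begin
    ⨁ (allFin n) g        ≡⟨ ⨁-allFin n g ⟩
    sum g                 ≈⟨ go i f g fi≈ε g≈f ⟩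
    g i ∙ sum f           ≡⟨ ≡.cong (g i ∙_) (⨁-allFin n f) ⟨
    g i ∙ ⨁ (allFin n) f  ∎
    where
    open import Algebra.Properties.Monoid.Sum monoid using (sum-cong-≋)
    go : ∀ {n} (i : Fin n) (f g : Fin n → Carrier) → f i ≈ ε → (∀ j → j ≢ i → g j ≈ f j) →
         sum g ≈ g i ∙ sum f
    go zero    f g fi≈ε g≈f = ∙-congˡ (trans (sum-cong-≋ (λ j → g≈f (suc j) λ ()))
      (trans (sym (identityˡ _)) (∙-congʳ (sym fi≈ε))))
    go (suc i) f g fi≈ε g≈f = begin
      g zero ∙ sum (g ∘ suc)
        ≈⟨ ∙-cong (g≈f zero λ ()) (go i (f ∘ suc) (g ∘ suc) fi≈ε (λ j j≢i → g≈f (suc j) λ { ≡.refl → j≢i ≡.refl })) ⟩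
      f zero ∙ (g (suc i) ∙ sum (f ∘ suc))
        ≈⟨ x∙yz≈y∙xz _ _ _ ⟩
      g (suc i) ∙ (f zero ∙ sum (f ∘ suc)) ∎

  ⨁-only : ∀ {n} (i : Fin n) (g : Fin n → Carrier) → (∀ j → j ≢ i → g j ≈ ε) →
           ⨁ (allFin n) g ≈ g i
  ⨁-only {n} i g g≈ε = trans (⨁-update i (λ _ → ε) g refl g≈ε)
    (trans (∙-congˡ (⨁-ε (allFin n))) (identityʳ _))

  -- Isolates coordinate `i`: the vectors are grouped by what remains after deleting that entry.
  -- This lets the parent of one vertex vary while all others stay fixed.
  ⨁-allVecs : ∀ (xs : List A) m (i : Fin (suc m)) (f : Vec A (suc m) → Carrier) →
              ⨁ (allVecs xs (suc m)) f ≈ ⨁ (allVecs xs m) (λ r → ⨁ xs (λ x → f (insertAt r i x)))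
  ⨁-allVecs xs m       zero    f = trans (⨁-cartesianProductWith _∷_ xs (allVecs xs m) f)
                                           (⨁-swap xs (allVecs xs m) _)
  ⨁-allVecs xs (suc m) (suc i) f = begin
    ⨁ (allVecs xs (suc (suc m))) f
      ≈⟨ ⨁-cartesianProductWith _∷_ xs (allVecs xs (suc m)) f ⟩
    ⨁ xs (λ x → ⨁ (allVecs xs (suc m)) (λ v → f (x ∷ v)))
      ≈⟨ ⨁-cong xs (λ x → ⨁-allVecs xs m i (λ v → f (x ∷ v))) ⟩
    ⨁ xs (λ x → ⨁ (allVecs xs m) (λ r → ⨁ xs (λ y → f (x ∷ insertAt r i y))))
      ≈⟨ ⨁-cartesianProductWith _∷_ xs (allVecs xs m) _ ⟨
    ⨁ (allVecs xs (suc m)) (λ r → ⨁ xs (λ y → f (insertAt r (suc i) y))) ∎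

-- Parent maps and grafting

ParentMap : ℕ → Set
ParentMap n = Fin n → Maybe (Fin n)

_≟ᴹ_ : B.DecidableEquality (Maybe (Fin n))
_≟ᴹ_ = Maybe.≡-dec _≟_

module _ (p : ParentMap n) where

  Parent : Rel (Fin n) _
  Parent x y = p x ≡ just y

  parent? : B.Decidable Parent
  parent? x y = p x ≟ᴹ just y

  -- Goes upwards from the first argument to the second, against the arcs of the digraph, and
  -- includes equality. Hence `Ancestor m i` says that `m` lies in the tree below `i`.
  Ancestor : Rel (Fin n) _
  Ancestor = Star Parent

  ancestor? : B.Decidable Ancestor
  ancestor? = star? parent?

  NoCycle : Set
  NoCycle = ∀ x y → Parent x y → ¬ Ancestor y x

  noCycle? : Dec NoCycle
  noCycle? = all? λ x → all? λ y → parent? x y →-dec ¬? (ancestor? y x)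

  -- Vertex first and root second, as in the entries `Q k i j`; `InTreeFrom` has the root first.
  Root : Rel (Fin n) _
  Root x j = p j ≡ nothing × Ancestor x j

  root? : B.Decidable Root
  root? x j = (p j ≟ᴹ nothing) ×-dec ancestor? x j

-- Going up is deterministic, so two upward walks from one vertex share their steps, and a walk
-- stops for good at a root.
root-unique : ∀ (p : ParentMap n) {x i j} → Root p x i → Root p x j → i ≡ j
root-unique p {i = i} {j} (pi , s) (pj , t) = go s t
  where
  go : ∀ {x} → Ancestor p x i → Ancestor p x j → i ≡ j
  go nil      nil      = ≡.refl
  go nil      (t ◅ _)  = contradiction (≡.trans (≡.sym pi) t) λ ()
  go (s ◅ _)  nil      = contradiction (≡.trans (≡.sym pj) s) λ ()
  go (s ◅ ss) (t ◅ ts) with ≡.refl ← ≡.trans (≡.sym s) t = go ss ts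

-- `q` is `p` with the root `i` hung below `m`. The two maps are related pointwise because in use
-- both are lookups in vectors that differ in one inserted entry.
module Graft (p q : ParentMap n) {i m} (pi : p i ≡ nothing) (qi : q i ≡ just m)
             (agree : ∀ x → x ≢ i → q x ≡ p x) where

  private
    ≢i : ∀ {x y} → Parent p x y → x ≢ i
    ≢i s ≡.refl = contradiction (≡.trans (≡.sym pi) s) λ ()

    raise : ∀ {x y} → Ancestor p x y → Ancestor q x y
    raise = Closure.map λ s → ≡.trans (agree _ (≢i s)) s

    raiseRoot : ∀ {j} → j ≢ i → p j ≡ nothing → q j ≡ nothing
    raiseRoot j≢i pj = ≡.trans (agree _ j≢i) pj

    lowerRoot : ∀ {j} → q j ≡ nothing → j ≢ i × p j ≡ nothing
    lowerRoot {j} qj = j≢i , ≡.trans (≡.sym (agree j j≢i)) qj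
      where
      j≢i : j ≢ i
      j≢i ≡.refl = contradiction (≡.trans (≡.sym qj) qi) λ ()

    -- Only the step from `i` to `m` is new. A walk that uses it is cut before its first use and
    -- after its last one, and both remaining stretches are walks in `p`; anything between is
    -- dropped, so repeated passages through `i` do no harm.
    lower : ∀ {x y} → Ancestor q x y → Ancestor p x y ⊎ (Ancestor p x i × Ancestor p m y)
    lower nil = inj₁ nil
    lower {x} (s ◅ ss) with x ≟ i | lower ss
    ... | no x≢i   | inj₁ t       = inj₁ (≡.trans (≡.sym (agree x x≢i)) s ◅ t)
    ... | no x≢i   | inj₂ (t , u) = inj₂ (≡.trans (≡.sym (agree x x≢i)) s ◅ t , u)
    ... | yes ≡.refl | t with ≡.refl ← ≡.trans (≡.sym qi) s | t
    ...   | inj₁ u       = inj₂ (nil , u)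
    ...   | inj₂ (_ , u) = inj₂ (nil , u)

  -- A cycle created by the graft passes through the new step, and its remainder is an old walk from
  -- `m` up to `i`.
  noCycle⇔ : NoCycle q ⇔ (NoCycle p × ¬ Ancestor p m i)
  noCycle⇔ = mk⇔ to (uncurry from)
    where
    to : NoCycle q → NoCycle p × ¬ Ancestor p m i
    to nq = (λ x y s t → nq x y (≡.trans (agree x (≢i s)) s) (raise t)) , λ t → nq _ _ qi (raise t)

    from : NoCycle p → ¬ Ancestor p m i → NoCycle q
    from np m↛i x y s t with x ≟ i
    from np m↛i x y s t | yes ≡.refl with ≡.refl ← ≡.trans (≡.sym qi) s | lower t
    ... | inj₁ u       = m↛i u
    ... | inj₂ (_ , u) = m↛i u
    from np m↛i x y s t | no x≢i with s′ ← ≡.trans (≡.sym (agree x x≢i)) s | lower t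
    -- Either the cycle avoids the new step and lies in `p`, or it is opened at the new step and
    -- read from `m` through `x` to `i`.
    ... | inj₁ u       = np x y s′ u
    ... | inj₂ (u , v) = m↛i (v ◅◅ (s′ ◅ u))

  root-below : ∀ {x j} → ¬ Ancestor p m i → Ancestor p x i → Root q x j ⇔ Root p m j
  root-below {x} {j} m↛i x→i = mk⇔ to from
    where
    to : Root q x j → Root p m j
    to (qj , s) with j≢i , pj ← lowerRoot qj | lower s
    -- A walk from `x` that avoids the graft would end at the old root of `x`, which is `i`, and `i`
    -- is no longer a root.
    ... | inj₁ t       = contradiction (root-unique p (pj , t) (pi , x→i)) j≢i
    ... | inj₂ (_ , t) = pj , t

    from : Root p m j → Root q x j
    from (pj , s) = raiseRoot (λ { ≡.refl → m↛i s }) pj , raise x→i ◅◅ (qi ◅ raise s)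

  root-apart : ∀ {x j} → ¬ Ancestor p x i → Root q x j ⇔ Root p x j
  root-apart {x} {j} x↛i = mk⇔ to from
    where
    to : Root q x j → Root p x j
    to (qj , s) with j≢i , pj ← lowerRoot qj | lower s
    ... | inj₁ t       = pj , t
    ... | inj₂ (t , _) = contradiction t x↛i

    from : Root p x j → Root q x j
    from (pj , s) = raiseRoot (λ { ≡.refl → x↛i s }) pj , raise s

-- Translation between parent maps and digraphs

toDigraph : ParentMap n → Digraph n
toDigraph p = Vec.tabulate λ a → Vec.tabulate λ b → does (parent? p b a)

private
  lookup-toDigraph : ∀ (p : ParentMap n) a b → lookup (lookup (toDigraph p) a) b ≡ does (parent? p b a)
  lookup-toDigraph p a b = ≡.trans (≡.cong (λ r → lookup r b) (lookup∘tabulate _ a)) (lookup∘tabulate _ b)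

arc⇔parent : ∀ (p : ParentMap n) {a b} → Arc (toDigraph p) a b ⇔ Parent p b a
arc⇔parent p {a} {b} = mk⇔ to λ s → lookup⇒[]= b _ (≡.trans (lookup-toDigraph p a b) (dec-true (parent? p b a) s))
  where
  to : Arc (toDigraph p) a b → Parent p b a
  to arc with parent? p b a | lookup-toDigraph p a b
  ... | yes s | _  = s
  ... | no _  | eq = contradiction (≡.trans (≡.sym eq) ([]=⇒lookup arc)) λ ()

does-arc : ∀ (p : ParentMap n) a b → does (arc? (toDigraph p) a b) ≡ does (parent? p b a)
does-arc p a b = does-⇔ (arc⇔parent p) (arc? (toDigraph p) a b) (parent? p b a)

module _ {c ℓ} (M : CommutativeMonoid c ℓ) where
  open CommutativeMonoid M using (Carrier; _∙_; _≈_; reflexive; setoid; trans) renaming (ε to e)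
  open ListSum M
  open import Relation.Binary.Reasoning.Setoid setoid

  -- An arbitrary monoid serves several readings: in the natural numbers under addition this
  -- computes indegrees, and `⨁-arcs`, built on it, gives the number of arcs there and the weight of
  -- the subgraph under multiplication of weights.
  ⨁-parents : ∀ (p : ParentMap n) b (f : Fin n → Carrier) →
    ⨁ (filter (λ a → arc? (toDigraph p) a b) (allFin n)) f ≈ maybe f e (p b)
  ⨁-parents {n} p b f = begin
    ⨁ (filter (λ a → arc? (toDigraph p) a b) (allFin n)) f
      ≈⟨ ⨁-filter _ (allFin n) f ⟩
    ⨁ (allFin n) (λ a → if does (arc? (toDigraph p) a b) then f a else e)
      ≈⟨ ⨁-cong (allFin n) (λ a → reflexive (≡.cong (λ z → if z then f a else e) (does-arc p a b))) ⟩
    ⨁ (allFin n) (λ a → if does (p b ≟ᴹ just a) then f a else e)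
      ≈⟨ only (p b) ⟩
    maybe f e (p b) ∎
    where
    only : ∀ v → ⨁ (allFin n) (λ a → if does (v ≟ᴹ just a) then f a else e) ≈ maybe f e v
    only nothing  = ⨁-ε (allFin n)
    only (just a) = trans
      (⨁-only a _ λ x x≢a → reflexive (≡.cong (λ z → if z then f x else e)
        (dec-false (just a ≟ᴹ just x) λ { ≡.refl → x≢a ≡.refl })))
      (reflexive (≡.cong (λ z → if z then f a else e) (dec-true (just a ≟ᴹ just a) ≡.refl)))

  ⨁-arcs : ∀ (p : ParentMap n) (f : Fin n × Fin n → Carrier) →
    ⨁ (arcs (toDigraph p)) f ≈ ⨁ (allFin n) (λ b → maybe (λ a → f (a , b)) e (p b))
  ⨁-arcs {n} p f = begin
    ⨁ (arcs (toDigraph p)) f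
      ≈⟨ ⨁-filter _ (cartesianProductWith _,_ (allFin n) (allFin n)) f ⟩
    ⨁ (cartesianProductWith _,_ (allFin n) (allFin n)) (λ ab → if does (uncurry (arc? (toDigraph p)) ab) then f ab else e)
      ≈⟨ ⨁-cartesianProductWith _,_ (allFin n) (allFin n) _ ⟩
    ⨁ (allFin n) (λ a → ⨁ (allFin n) (λ b → if does (arc? (toDigraph p) a b) then f (a , b) else e))
      ≈⟨ ⨁-swap (allFin n) (allFin n) _ ⟩
    ⨁ (allFin n) (λ b → ⨁ (allFin n) (λ a → if does (arc? (toDigraph p) a b) then f (a , b) else e))
      ≈⟨ ⨁-cong (allFin n) (λ b → ⨁-filter (λ a → arc? (toDigraph p) a b) (allFin n) (λ a → f (a , b))) ⟨
    ⨁ (allFin n) (λ b → ⨁ (filter (λ a → arc? (toDigraph p) a b) (allFin n)) (λ a → f (a , b)))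
      ≈⟨ ⨁-cong (allFin n) (λ b → ⨁-parents p b (λ a → f (a , b))) ⟩
    ⨁ (allFin n) (λ b → maybe (λ a → f (a , b)) e (p b)) ∎

open ListSum ℕ.+-0-commutativeMonoid using () renaming (⨁ to Σℕ)

length-Σℕ : ∀ {a} {A : Set a} (xs : List A) → length xs ≡ Σℕ xs (λ _ → 1)
length-Σℕ []       = ≡.refl
length-Σℕ (x ∷ xs) = ≡.cong suc (length-Σℕ xs)

arcCount : Maybe (Fin n) → ℕ
arcCount = maybe (λ _ → 1) 0

#arcs : ParentMap n → ℕ
#arcs p = Σℕ (allFin _) (λ b → arcCount (p b))

length-arcs : ∀ (p : ParentMap n) → length (arcs (toDigraph p)) ≡ #arcs p
length-arcs p = ≡.trans (length-Σℕ (arcs (toDigraph p))) (⨁-arcs ℕ.+-0-commutativeMonoid p (λ _ → 1))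

indegree-toDigraph : ∀ (p : ParentMap n) b → indegree (toDigraph p) b ≡ arcCount (p b)
indegree-toDigraph p b = ≡.trans
  (length-Σℕ (filter (λ a → arc? (toDigraph p) a b) (allFin _)))
  (⨁-parents ℕ.+-0-commutativeMonoid p b (λ _ → 1))

indegree≤1 : ∀ (p : ParentMap n) b → indegree (toDigraph p) b ≤ 1
indegree≤1 p b = ≡.subst (_≤ 1) (≡.sym (indegree-toDigraph p b)) (le (p b))
  where
  le : ∀ v → arcCount v ≤ 1
  le (just _) = s≤s z≤n
  le nothing  = z≤n

indegree≡0⇔ : ∀ (p : ParentMap n) b → indegree (toDigraph p) b ≡ 0 ⇔ p b ≡ nothing
indegree≡0⇔ p b = mk⇔ (λ eq → to (p b) (≡.trans (≡.sym (indegree-toDigraph p b)) eq))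
                      (λ eq → ≡.trans (indegree-toDigraph p b) (≡.cong arcCount eq))
  where
  to : ∀ v → arcCount v ≡ 0 → v ≡ nothing
  to nothing _ = ≡.refl

acyclic⇔noCycle : ∀ (p : ParentMap n) → Acyclic (toDigraph p) ⇔ NoCycle p
acyclic⇔noCycle p = mk⇔
  (λ ac x y s t → ac y (close (Equivalence.from (arc⇔parent p) s) (reverse (Equivalence.from (arc⇔parent p)) t)))
  (λ nc i t → let k , a , s = split t in
    nc k i (Equivalence.to (arc⇔parent p) a) (reverse (Equivalence.to (arc⇔parent p)) s))
  where
  close : ∀ {i j k} → Arc (toDigraph p) i j → Star (Arc (toDigraph p)) j k → TransClosure (Arc (toDigraph p)) i k
  close a nil      = [ a ]
  close a (b ◅ bs) = a ∷ close b bs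

  split : ∀ {i j} → TransClosure (Arc (toDigraph p)) i j → ∃[ k ] (Arc (toDigraph p) i k × Star (Arc (toDigraph p)) k j)
  split [ a ]    = _ , a , nil
  split (a ∷ as) = let _ , b , bs = split as in _ , a , b ◅ bs

-- An undirected walk that starts at a root `j` stays below `j`. A step down prolongs the upward
-- walk back to `j`; a step up must retrace its first step, since parents are unique, and is
-- impossible at `j` itself.
inTreeFrom⇔root : ∀ (p : ParentMap n) j x → InTreeFrom (toDigraph p) j x ⇔ Root p x j
inTreeFrom⇔root p j x = mk⇔
  (λ (d , w) → let pj = Equivalence.to (indegree≡0⇔ p j) d in pj , walk pj nil w)
  (λ (pj , s) → Equivalence.from (indegree≡0⇔ p j) pj , reverse (fwd ∘ Equivalence.from (arc⇔parent p)) s)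
  where
  walk : p j ≡ nothing → ∀ {y z} → Ancestor p y j → WeaklyConnected (toDigraph p) y z → Ancestor p z j
  walk pj s   nil           = s
  walk pj s   (fwd arc ◅ w) = walk pj (Equivalence.to (arc⇔parent p) arc ◅ s) w
  walk pj nil (bwd arc ◅ w) = contradiction (≡.trans (≡.sym pj) (Equivalence.to (arc⇔parent p) arc)) λ ()
  walk pj (t ◅ s) (bwd arc ◅ w) with ≡.refl ← ≡.trans (≡.sym t) (Equivalence.to (arc⇔parent p) arc) = walk pj s w

toDigraph-injective : ∀ (p q : ParentMap n) → toDigraph p ≡ toDigraph q → ∀ b → p b ≡ q b
toDigraph-injective {n} p q eq b = go (p b) (q b) ≡.refl ≡.refl
  where
  move : ∀ (p q : ParentMap n) → toDigraph p ≡ toDigraph q → ∀ {a} → Parent p b a → Parent q b a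
  move p q eq s = Equivalence.to (arc⇔parent q) (≡.subst (λ H → Arc H _ b) eq (Equivalence.from (arc⇔parent p) s))

  go : ∀ u v → p b ≡ u → q b ≡ v → p b ≡ q b
  go (just a) _        pb qb = ≡.trans pb (≡.sym (move p q eq pb))
  go nothing  (just a) pb qb = ≡.trans (move q p (≡.sym eq) qb) (≡.sym qb)
  go nothing  nothing  pb qb = ≡.trans pb (≡.sym qb)

fromDigraph : Digraph n → ParentMap n
fromDigraph H b with any? (λ a → arc? H a b)
... | yes (a , _) = just a
... | no _        = nothing

-- `fromDigraph` takes whichever arc into `b` the search finds; indegree at most 1 makes this the
-- only one, so no arc is lost.
toDigraph-fromDigraph : ∀ (H : Digraph n) → (∀ b → indegree H b ≤ 1) → toDigraph (fromDigraph H) ≡ H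
toDigraph-fromDigraph H in≤1 = ≡.trans
  (tabulate-cong λ a → ≡.trans (tabulate-cong (entry a)) (tabulate∘lookup (lookup H a)))
  (tabulate∘lookup H)
  where
  atMostOne : ∀ {A : Set} {xs : List A} {x y} → length xs ≤ 1 → x ∈ˡ xs → y ∈ˡ xs → x ≡ y
  atMostOne _        (here ≡.refl)        (here ≡.refl) = ≡.refl
  atMostOne (s≤s ()) (here _)  (there (here _))
  atMostOne (s≤s ()) (here _)  (there (there _))
  atMostOne (s≤s ()) (there (here _)) _
  atMostOne (s≤s ()) (there (there _)) _

  unique : ∀ {a a′ b} → Arc H a b → Arc H a′ b → a ≡ a′
  unique {b = b} s t = atMostOne (in≤1 b)
    (∈-filter⁺ (λ a → arc? H a b) (∈-allFin _) s) (∈-filter⁺ (λ a → arc? H a b) (∈-allFin _) t)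

  to : ∀ a b → Parent (fromDigraph H) b a → Arc H a b
  to a b s with any? (λ a → arc? H a b)
  to a b ≡.refl | yes (_ , arc) = arc

  from : ∀ a b → Arc H a b → Parent (fromDigraph H) b a
  from a b arc with any? (λ a → arc? H a b)
  ... | yes (_ , arc′) = ≡.cong just (unique arc′ arc)
  ... | no ¬arc        = contradiction (a , arc) ¬arc

  entry : ∀ a b → does (parent? (fromDigraph H) b a) ≡ lookup (lookup H a) b
  entry a b with lookup (lookup H a) b in eq
  ... | true  = dec-true (parent? (fromDigraph H) b a) (from a b (lookup⇒[]= b _ eq))
  ... | false = dec-false (parent? (fromDigraph H) b a) λ s →
    contradiction (≡.trans (≡.sym eq) ([]=⇒lookup (to a b s))) λ ()

-- Indicators of decidable propositions

module Indicators {c ℓ} (R : CommutativeSemiring c ℓ) where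
  open CommutativeSemiring R
  open ListSum +-commutativeMonoid public using ()
    renaming (⨁ to Σ[_]; ⨁-cong to Σ-cong; ⨁-∙ to Σ-+; ⨁-swap to Σ-swap; ⨁-map to Σ-map;
              ⨁-allVecs to Σ-allVecs; ⨁-filter to Σ-filter; ⨁-↭ to Σ-↭; ⨁-allFin to Σ-allFin;
              ⨁-only to Σ-only)
  open ListSum *-commutativeMonoid public using () renaming (⨁ to Π[_]; ⨁-update to Π-update)
  open import Relation.Binary.Reasoning.Setoid setoid
  open import Algebra.Solver.Ring.NaturalCoefficients.Default R using (solve; _:=_; _:+_; _:*_)

  private
    variable
      P P′ : Set b

  Σ-*ˡ : ∀ (xs : List A) y (f : A → Carrier) → Σ[ xs ] (λ x → y * f x) ≈ y * Σ[ xs ] f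
  Σ-*ˡ []       y f = sym (zeroʳ y)
  Σ-*ˡ (x ∷ xs) y f = trans (+-congˡ (Σ-*ˡ xs y f)) (sym (distribˡ y _ _))

  Σ-*ʳ : ∀ (xs : List A) y (f : A → Carrier) → Σ[ xs ] (λ x → f x * y) ≈ Σ[ xs ] f * y
  Σ-*ʳ xs y f = trans (Σ-cong xs (λ x → *-comm (f x) y)) (trans (Σ-*ˡ xs y f) (*-comm y _))

  Π-zero : ∀ {xs : List A} {x} (f : A → Carrier) → x ∈ˡ xs → f x ≈ 0# → Π[ xs ] f ≈ 0#
  Π-zero f (here ≡.refl) eq = trans (*-congʳ eq) (zeroˡ _)
  Π-zero f (there m)     eq = trans (*-congˡ (Π-zero f m eq)) (zeroʳ _)

  𝟙 : Dec P → Carrier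
  𝟙 p? = if does p? then 1# else 0#

  𝟙-true : ∀ (p? : Dec P) → P → 𝟙 p? ≡ 1#
  𝟙-true p? p = ≡.cong (if_then 1# else 0#) (dec-true p? p)

  𝟙-false : ∀ (p? : Dec P) → ¬ P → 𝟙 p? ≡ 0#
  𝟙-false p? ¬p = ≡.cong (if_then 1# else 0#) (dec-false p? ¬p)

  𝟙-⇔ : P ⇔ P′ → (p? : Dec P) (q? : Dec P′) → 𝟙 p? ≡ 𝟙 q?
  𝟙-⇔ p⇔q p? q? = ≡.cong (if_then 1# else 0#) (does-⇔ p⇔q p? q?)

  𝟙-× : ∀ (p? : Dec P) (q? : Dec P′) → 𝟙 (p? ×-dec q?) ≈ 𝟙 p? * 𝟙 q?
  𝟙-× p? q? with does p?
  ... | true  = sym (*-identityˡ _)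
  ... | false = sym (zeroˡ _)

  𝟙-¬ : ∀ (p? : Dec P) → 𝟙 (¬? p?) + 𝟙 p? ≈ 1#
  𝟙-¬ p? with does p?
  ... | true  = +-identityˡ 1#
  ... | false = +-identityʳ 1#

  -- Rewriting under a condition: the equality is wanted only where the indicator is 1. Facts valid
  -- just for `m` outside the tree, or just for `x` inside it, enter the algebra this way.
  𝟙-cong : ∀ (p? : Dec P) {x y} → (P → x ≈ y) → 𝟙 p? * x ≈ 𝟙 p? * y
  𝟙-cong (yes p) x≈y = *-congˡ (x≈y p)
  𝟙-cong (no _)  _   = trans (zeroˡ _) (sym (zeroˡ _))

  Σ-filter-𝟙 : ∀ {p} {P : A → Set p} (P? : ∀ x → Dec (P x)) xs (f : A → Carrier) →
               Σ[ filter P? xs ] f ≈ Σ[ xs ] (λ x → 𝟙 (P? x) * f x)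
  Σ-filter-𝟙 P? xs f = trans (Σ-filter P? xs f) (Σ-cong xs λ x → if-* x)
    where
    if-* : ∀ x → (if does (P? x) then f x else 0#) ≈ 𝟙 (P? x) * f x
    if-* x with does (P? x)
    ... | true  = sym (*-identityˡ _)
    ... | false = sym (zeroˡ _)

  -- t and s are the indicators of the complement of a tree T and of T itself,
  -- d tells whether its root is the target vertex, and A₁, A₂, A₃ stand for base
  -- forests with k+1, k and k-1 arcs.  In the A₃ part both sides sum over
  -- pairs (x, m) with m ∉ T; the pairs with x ∉ T too agree only after a swap.
  graft-identity : ∀ (xs : List A) (e t s ρ : A → Carrier) A₁ A₂ A₃ d →
    (∀ x → t x + s x ≈ 1#) → (∀ x → s x * ρ x ≈ s x * d) →
    (A₁ * d + A₂ * Σ[ xs ] (λ m → t m * (e m * ρ m))) +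
      Σ[ xs ] e * (A₂ * d + A₃ * Σ[ xs ] (λ m → t m * (e m * ρ m)))
    ≈ d * (A₁ * 1# + A₂ * Σ[ xs ] (λ m → t m * (e m * 1#))) +
      Σ[ xs ] (λ x → e x * (A₂ * ρ x + A₃ * Σ[ xs ] (λ m → t m * (e m * (t x * ρ x + s x * ρ m)))))
  graft-identity {A = A} xs e t s ρ A₁ A₂ A₃ d t+s sρ = begin
    (A₁ * d + A₂ * S) + E * (A₂ * d + A₃ * S)
      ≈⟨ solve 6 (λ A₁ A₂ A₃ d S E → (A₁ :* d :+ A₂ :* S) :+ E :* (A₂ :* d :+ A₃ :* S) :=
                    A₁ :* d :+ A₂ :* (S :+ E :* d) :+ A₃ :* (E :* S)) refl A₁ A₂ A₃ d S E ⟩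
    A₁ * d + A₂ * (S + E * d) + A₃ * (E * S)
      ≈⟨ +-cong (+-congˡ (*-congˡ single)) (*-congˡ double) ⟩
    A₁ * d + A₂ * (d * S₀ + Σ[ xs ] (λ x → e x * ρ x)) + A₃ * Σ[ xs ] (λ x → e x * U x)
      ≈⟨ solve 7 (λ A₁ A₂ A₃ d S₀ X Y → A₁ :* d :+ A₂ :* (d :* S₀ :+ X) :+ A₃ :* Y :=
                    d :* (A₁ :+ A₂ :* S₀) :+ (A₂ :* X :+ A₃ :* Y)) refl A₁ A₂ A₃ d S₀ _ _ ⟩
    d * (A₁ + A₂ * S₀) + (A₂ * Σ[ xs ] (λ x → e x * ρ x) + A₃ * Σ[ xs ] (λ x → e x * U x))
      ≈⟨ +-cong (*-congˡ (+-congʳ (sym (*-identityʳ A₁)))) (sym spread) ⟩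
    d * (A₁ * 1# + A₂ * S₀) + Σ[ xs ] (λ x → e x * (A₂ * ρ x + A₃ * U x)) ∎
    where
    S S₀ E : Carrier
    S  = Σ[ xs ] (λ m → t m * (e m * ρ m))
    S₀ = Σ[ xs ] (λ m → t m * (e m * 1#))
    E  = Σ[ xs ] e
    U : A → Carrier
    U x = Σ[ xs ] (λ m → t m * (e m * (t x * ρ x + s x * ρ m)))

    spread : Σ[ xs ] (λ x → e x * (A₂ * ρ x + A₃ * U x)) ≈ A₂ * Σ[ xs ] (λ x → e x * ρ x) + A₃ * Σ[ xs ] (λ x → e x * U x)
    spread = begin
      Σ[ xs ] (λ x → e x * (A₂ * ρ x + A₃ * U x))
        ≈⟨ Σ-cong xs (λ x → solve 5 (λ e A₂ r A₃ U → e :* (A₂ :* r :+ A₃ :* U) := A₂ :* (e :* r) :+ A₃ :* (e :* U))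
                               refl (e x) A₂ (ρ x) A₃ (U x)) ⟩
      Σ[ xs ] (λ x → A₂ * (e x * ρ x) + A₃ * (e x * U x))
        ≈⟨ Σ-+ xs _ _ ⟩
      Σ[ xs ] (λ x → A₂ * (e x * ρ x)) + Σ[ xs ] (λ x → A₃ * (e x * U x))
        ≈⟨ +-cong (Σ-*ˡ xs A₂ _) (Σ-*ˡ xs A₃ _) ⟩
      A₂ * Σ[ xs ] (λ x → e x * ρ x) + A₃ * Σ[ xs ] (λ x → e x * U x) ∎

    -- The part with coefficient `A₂` agrees vertex by vertex. Splitting `e x` by `t x + s x`, the
    -- terms inside the tree match because the root there is the target exactly when `d` says so.
    single : S + E * d ≈ d * S₀ + Σ[ xs ] (λ x → e x * ρ x)
    single = begin
      S + E * d
        ≈⟨ +-congˡ (Σ-*ʳ xs d e) ⟨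
      S + Σ[ xs ] (λ x → e x * d)
        ≈⟨ Σ-+ xs _ _ ⟨
      Σ[ xs ] (λ x → t x * (e x * ρ x) + e x * d)
        ≈⟨ Σ-cong xs pointwise ⟩
      Σ[ xs ] (λ x → d * (t x * (e x * 1#)) + e x * ρ x)
        ≈⟨ Σ-+ xs _ _ ⟩
      Σ[ xs ] (λ x → d * (t x * (e x * 1#))) + Σ[ xs ] (λ x → e x * ρ x)
        ≈⟨ +-congʳ (Σ-*ˡ xs d _) ⟩
      d * S₀ + Σ[ xs ] (λ x → e x * ρ x) ∎
      where
      pointwise : ∀ x → t x * (e x * ρ x) + e x * d ≈ d * (t x * (e x * 1#)) + e x * ρ x
      pointwise x = begin
        t x * (e x * ρ x) + e x * d
          ≈⟨ +-congˡ (trans (*-congʳ (sym (*-identityʳ (e x)))) (*-congʳ (*-congˡ (sym (t+s x))))) ⟩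
        t x * (e x * ρ x) + e x * (t x + s x) * d
          ≈⟨ solve 5 (λ t s e r d → t :* (e :* r) :+ e :* (t :+ s) :* d :=
                       (t :* (e :* r) :+ d :* (t :* e)) :+ e :* (s :* d)) refl (t x) (s x) (e x) (ρ x) d ⟩
        (t x * (e x * ρ x) + d * (t x * e x)) + e x * (s x * d)
          ≈⟨ +-congˡ (*-congˡ (sym (sρ x))) ⟩
        (t x * (e x * ρ x) + d * (t x * e x)) + e x * (s x * ρ x)
          ≈⟨ solve 5 (λ t s e r d → (t :* (e :* r) :+ d :* (t :* e)) :+ e :* (s :* r) :=
                       d :* (t :* e) :+ e :* (t :+ s) :* r) refl (t x) (s x) (e x) (ρ x) d ⟩
        d * (t x * e x) + e x * (t x + s x) * ρ x
          ≈⟨ +-cong (*-congˡ (*-congˡ (sym (*-identityʳ (e x)))))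
                   (*-congʳ (trans (*-congˡ (t+s x)) (*-identityʳ (e x)))) ⟩
        d * (t x * (e x * 1#)) + e x * ρ x ∎

    double : E * S ≈ Σ[ xs ] (λ x → e x * U x)
    double = begin
      E * S
        ≈⟨ Σ-*ʳ xs S e ⟨
      Σ[ xs ] (λ x → e x * S)
        ≈⟨ Σ-cong xs (λ x → trans (sym (Σ-*ˡ xs (e x) _)) (Σ-cong xs (λ m → splitˡ x m))) ⟩
      Σ[ xs ] (λ x → Σ[ xs ] (λ m → V x m + W x m))
        ≈⟨ Σ-cong xs (λ x → Σ-+ xs (V x) (W x)) ⟩
      Σ[ xs ] (λ x → Σ[ xs ] (V x) + Σ[ xs ] (W x))
        ≈⟨ Σ-+ xs _ _ ⟩
      Σ[ xs ] (λ x → Σ[ xs ] (V x)) + Σ[ xs ] (λ x → Σ[ xs ] (W x))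
        -- In `V` both vertices lie outside the tree, and the left side takes the root of `m` where
        -- the right side takes that of `x`; exchanging the names is legitimate since the two
        -- weights occur symmetrically. The `W` terms already match.
        ≈⟨ +-congʳ (Σ-swap xs xs V) ⟩
      Σ[ xs ] (λ x → Σ[ xs ] (λ m → V m x)) + Σ[ xs ] (λ x → Σ[ xs ] (W x))
        ≈⟨ Σ-+ xs _ _ ⟨
      Σ[ xs ] (λ x → Σ[ xs ] (λ m → V m x) + Σ[ xs ] (W x))
        ≈⟨ Σ-cong xs (λ x → Σ-+ xs (λ m → V m x) (W x)) ⟨
      Σ[ xs ] (λ x → Σ[ xs ] (λ m → V m x + W x m))
        ≈⟨ Σ-cong xs (λ x → trans (Σ-cong xs (λ m → splitʳ x m)) (Σ-*ˡ xs (e x) _)) ⟩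
      Σ[ xs ] (λ x → e x * U x) ∎
      where
      V W : A → A → Carrier
      V x m = (e x * t x) * (t m * (e m * ρ m))
      W x m = (e x * s x) * (t m * (e m * ρ m))

      splitˡ : ∀ x m → e x * (t m * (e m * ρ m)) ≈ V x m + W x m
      splitˡ x m = begin
        e x * (t m * (e m * ρ m))
          ≈⟨ *-congʳ (trans (*-congˡ (t+s x)) (*-identityʳ (e x))) ⟨
        e x * (t x + s x) * (t m * (e m * ρ m))
          ≈⟨ trans (*-congʳ (distribˡ _ _ _)) (distribʳ _ _ _) ⟩
        V x m + W x m ∎

      splitʳ : ∀ x m → V m x + W x m ≈ e x * (t m * (e m * (t x * ρ x + s x * ρ m)))
      splitʳ x m = solve 8 (λ ex tx sx rx em tm sm rm →
        (em :* tm) :* (tx :* (ex :* rx)) :+ (ex :* sx) :* (tm :* (em :* rm)) :=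
        ex :* (tm :* (em :* (tx :* rx :+ sx :* rm)))) refl (e x) (t x) (s x) (ρ x) (e m) (t m) (s m) (ρ m)

-- The recurrence for weighted forest sums

lookup-insertAt-≢ : ∀ {a} {A : Set a} {n} (r : Vec A n) {i j} x y → j ≢ i →
                    lookup (insertAt r i x) j ≡ lookup (insertAt r i y) j
lookup-insertAt-≢ r {i} {j} x y j≢i = begin
  lookup (insertAt r i x) j             ≡⟨ ≡.cong (lookup (insertAt r i x)) (punchIn-punchOut i≢j) ⟨
  lookup (insertAt r i x) (punchIn i k) ≡⟨ insertAt-punchIn r i x k ⟩
  lookup r k                            ≡⟨ insertAt-punchIn r i y k ⟨
  lookup (insertAt r i y) (punchIn i k) ≡⟨ ≡.cong (lookup (insertAt r i y)) (punchIn-punchOut i≢j) ⟩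
  lookup (insertAt r i y) j             ∎
  where
  open ≡.≡-Reasoning
  i≢j : i ≢ j
  i≢j = j≢i ∘ ≡.sym
  k = punchOut i≢j

parentOptions : ∀ n → List (Maybe (Fin n))
parentOptions n = nothing ∷ map just (allFin n)

allParents : ∀ n → List (Vec (Maybe (Fin n)) n)
allParents n = allVecs (parentOptions n) n

module ForestSums {c ℓ} (R : CommutativeSemiring c ℓ) {n}
                  (w : Fin n → Fin n → CommutativeSemiring.Carrier R) where
  open CommutativeSemiring R
  open Indicators R
  open import Relation.Binary.Reasoning.Setoid setoid
  open import Algebra.Solver.Ring.NaturalCoefficients.Default R using (solve; _:=_; _:+_; _:*_)

  weightOf : ParentMap n → Carrier
  weightOf p = Π[ allFin n ] (λ b → maybe (λ a → w a b) 1# (p b))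

  -- The factor `h` is either the constant 1, for the total weight, or the indicator of a root, for
  -- an entry of the forest matrix.
  term : ℕ → (ParentMap n → Carrier) → ParentMap n → Carrier
  term k h p = 𝟙 (noCycle? p) * 𝟙 (#arcs p ℕ.≟ k) * weightOf p * h p

  forestSum : ℕ → (ParentMap n → Carrier) → Carrier
  forestSum k h = Σ[ allParents n ] (term k h ∘ lookup)

  module _ (p q : ParentMap n) {i m} (pi : p i ≡ nothing) (qi : q i ≡ just m)
           (agree : ∀ x → x ≢ i → q x ≡ p x) where
    open Graft p q pi qi agree
    open ListSum ℕ.+-0-commutativeMonoid using () renaming (⨁-update to Σℕ-update)

    #arcs-graft : #arcs q ≡ suc (#arcs p)
    #arcs-graft = ≡.trans
      (Σℕ-update i _ _ (≡.cong arcCount pi) (λ x x≢i → ≡.cong arcCount (agree x x≢i)))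
      (≡.cong (λ v → arcCount v ℕ.+ #arcs p) qi)

    weightOf-graft : weightOf q ≈ w m i * weightOf p
    weightOf-graft = trans
      (Π-update i _ _ (reflexive (≡.cong (maybe _ 1#) pi))
        (λ x x≢i → reflexive (≡.cong (maybe (λ a → w a x) 1#) (agree x x≢i))))
      (*-congʳ (reflexive (≡.cong (maybe _ 1#) qi)))

    -- Everything is expressed through `p`, so that along a fibre only the indicator of `m` being
    -- outside the tree, the new arc weight and `h q` vary with `m`.
    term-graft : ∀ k h → term k h q ≈
      𝟙 (noCycle? p) * 𝟙 (suc (#arcs p) ℕ.≟ k) * weightOf p * (𝟙 (¬? (ancestor? p m i)) * (w m i * h q))
    term-graft k h = begin
      𝟙 (noCycle? q) * 𝟙 (#arcs q ℕ.≟ k) * weightOf q * h q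
        ≈⟨ *-congʳ (*-cong (*-cong
             (trans (reflexive (𝟙-⇔ noCycle⇔ (noCycle? q) (noCycle? p ×-dec ¬? (ancestor? p m i))))
               (𝟙-× (noCycle? p) (¬? (ancestor? p m i))))
             (reflexive (≡.cong (λ N → 𝟙 (N ℕ.≟ k)) #arcs-graft))) weightOf-graft) ⟩
      (𝟙 (noCycle? p) * 𝟙 (¬? (ancestor? p m i))) * 𝟙 (suc (#arcs p) ℕ.≟ k) * (w m i * weightOf p) * h q
        ≈⟨ solve 6 (λ c t N w W h → (c :* t) :* N :* (w :* W) :* h := c :* N :* W :* (t :* (w :* h))) refl
             (𝟙 (noCycle? p)) (𝟙 (¬? (ancestor? p m i))) (𝟙 (suc (#arcs p) ℕ.≟ k)) (w m i) (weightOf p) (h q) ⟩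
      𝟙 (noCycle? p) * 𝟙 (suc (#arcs p) ℕ.≟ k) * weightOf p * (𝟙 (¬? (ancestor? p m i)) * (w m i * h q)) ∎

    root-graft : ∀ x j → 𝟙 (¬? (ancestor? p m i)) * 𝟙 (root? q x j) ≈
      𝟙 (¬? (ancestor? p m i)) *
        (𝟙 (¬? (ancestor? p x i)) * 𝟙 (root? p x j) + 𝟙 (ancestor? p x i) * 𝟙 (root? p m j))
    root-graft x j = 𝟙-cong (¬? (ancestor? p m i)) λ m↛i → begin
      𝟙 (root? q x j)
        ≈⟨ trans (*-congʳ (𝟙-¬ (ancestor? p x i))) (*-identityˡ _) ⟨
      (𝟙 (¬? (ancestor? p x i)) + 𝟙 (ancestor? p x i)) * 𝟙 (root? q x j)
        ≈⟨ distribʳ _ _ _ ⟩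
      𝟙 (¬? (ancestor? p x i)) * 𝟙 (root? q x j) + 𝟙 (ancestor? p x i) * 𝟙 (root? q x j)
        ≈⟨ +-cong (𝟙-cong (¬? (ancestor? p x i)) λ x↛i → reflexive (𝟙-⇔ (root-apart x↛i) (root? q x j) (root? p x j)))
                  (𝟙-cong (ancestor? p x i) λ x→i → reflexive (𝟙-⇔ (root-below m↛i x→i) (root? q x j) (root? p m j))) ⟩
      𝟙 (¬? (ancestor? p x i)) * 𝟙 (root? p x j) + 𝟙 (ancestor? p x i) * 𝟙 (root? p m j) ∎

  -- The recurrence when only the parent of one vertex varies

  fibre : ParentMap n → (Fin n → ParentMap n) → ℕ → (ParentMap n → Carrier) → Carrier
  fibre p q k h = term k h p + Σ[ allFin n ] (λ m → term k h (q m))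

  module _ (p : ParentMap n) (q : Fin n → ParentMap n) {i} (pi : p i ≡ nothing)
           (qi : ∀ m → q m i ≡ just m) (agree : ∀ m x → x ≢ i → q m x ≡ p x) where

    private
      t s : Fin n → Carrier
      t m = 𝟙 (¬? (ancestor? p m i))
      s m = 𝟙 (ancestor? p m i)

      α : ℕ → Carrier
      α k = 𝟙 (noCycle? p) * 𝟙 (#arcs p ℕ.≟ k) * weightOf p

      -- The case of k - 1 arcs in the base forest, to which grafting adds one. Writing it with
      -- `suc` instead of a truncated subtraction makes it vanish at `k = 0`.
      α′ : ℕ → Carrier
      α′ k = 𝟙 (noCycle? p) * 𝟙 (suc (#arcs p) ℕ.≟ k) * weightOf p

      root : Fin n → Fin n → ParentMap n → Carrier
      root x j p = 𝟙 (root? p x j)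

      one : ParentMap n → Carrier
      one _ = 1#

      -- `h′` gives the value after grafting in terms of `p` and has to be correct only for those
      -- `m` that may be used.
      fibre-expand : ∀ k h (h′ : Fin n → Carrier) → (∀ m → t m * h (q m) ≈ t m * h′ m) →
        fibre p q k h ≈ α k * h p + α′ k * Σ[ allFin n ] (λ m → t m * (w m i * h′ m))
      fibre-expand k h h′ eq = +-congˡ (trans (Σ-cong (allFin n) graft) (Σ-*ˡ (allFin n) (α′ k) _))
        where
        commute : ∀ a b c → a * (b * c) ≈ b * (a * c)
        commute = solve 3 (λ a b c → a :* (b :* c) := b :* (a :* c)) refl
        graft : ∀ m → term k h (q m) ≈ α′ k * (t m * (w m i * h′ m))
        graft m = trans (term-graft p (q m) pi (qi m) (agree m) k h) (*-congˡ
          (trans (commute (t m) (w m i) (h (q m))) (trans (*-congˡ (eq m)) (commute (w m i) (t m) (h′ m)))))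

      root-i : ∀ {x} j → Ancestor p x i → root x j p ≡ 𝟙 (i ≟ j)
      root-i j x→i = 𝟙-⇔ (mk⇔ (root-unique p (pi , x→i)) λ { ≡.refl → pi , x→i }) (root? p _ j) (i ≟ j)

      fibre-root-i : ∀ k j → fibre p q k (root i j) ≈
        α k * 𝟙 (i ≟ j) + α′ k * Σ[ allFin n ] (λ m → t m * (w m i * root m j p))
      fibre-root-i k j = trans
        (fibre-expand k (root i j) (λ m → root m j p) λ m →
          𝟙-cong (¬? (ancestor? p m i)) λ m↛i →
            reflexive (𝟙-⇔ (Graft.root-below p (q m) pi (qi m) (agree m) m↛i nil) (root? (q m) i j) (root? p m j)))
        (+-congʳ (*-congˡ (reflexive (root-i j nil))))

    -- Without arcs `i` cannot have a parent, so only the ungrafted summand survives, and there `i`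
    -- is its own root.
    fibre-zero : ∀ j → fibre p q 0 (root i j) ≈ 𝟙 (i ≟ j) * fibre p q 0 one
    fibre-zero j = begin
      fibre p q 0 (root i j)
        ≈⟨ fibre-root-i 0 j ⟩
      α 0 * 𝟙 (i ≟ j) + α′ 0 * _
        ≈⟨ +-congˡ (vanish _) ⟩
      α 0 * 𝟙 (i ≟ j) + 0#
        ≈⟨ trans (+-identityʳ _) (*-comm _ _) ⟩
      𝟙 (i ≟ j) * α 0
        ≈⟨ *-congˡ (trans (+-cong (*-identityʳ _) (vanish _)) (+-identityʳ _)) ⟨
      𝟙 (i ≟ j) * (α 0 * 1# + α′ 0 * _)
        ≈⟨ *-congˡ (fibre-expand 0 one one′ λ _ → refl) ⟨
      𝟙 (i ≟ j) * fibre p q 0 one ∎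
      where
      one′ : Fin n → Carrier
      one′ _ = 1#
      vanish : ∀ y → α′ 0 * y ≈ 0#
      vanish y = trans (*-congʳ (trans (*-congʳ (zeroʳ _)) (zeroˡ _))) (zeroˡ y)

    fibre-suc : ∀ k j →
      fibre p q (suc k) (root i j) + Σ[ allFin n ] (λ x → w x i) * fibre p q k (root i j) ≈
      𝟙 (i ≟ j) * fibre p q (suc k) one + Σ[ allFin n ] (λ x → w x i * fibre p q k (root x j))
    fibre-suc k j = begin
      fibre p q (suc k) (root i j) + Σ[ allFin n ] (λ x → w x i) * fibre p q k (root i j)
        ≈⟨ +-cong (fibre-root-i (suc k) j) (*-congˡ (fibre-root-i k j)) ⟩
      _
        -- The expansion for `suc k` ends in `α′ (suc k)`, which computes to `α k`: the indicator
        -- sees only the Boolean test, and that strips both successors. Hence three coefficients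
        -- suffice for the two levels.
        ≈⟨ graft-identity (allFin n) (λ x → w x i) t s (λ m → root m j p) (α (suc k)) (α k) (α′ k) (𝟙 (i ≟ j))
             (λ x → 𝟙-¬ (ancestor? p x i)) (λ x → 𝟙-cong (ancestor? p x i) λ x→i → reflexive (root-i j x→i)) ⟩
      _
        ≈⟨ +-cong (*-congˡ (fibre-expand (suc k) one (λ _ → 1#) λ _ → refl))
             (Σ-cong (allFin n) λ x → *-congˡ (fibre-expand k (root x j) (λ m → t x * root x j p + s x * root m j p) λ m →
               root-graft p (q m) pi (qi m) (agree m) x j)) ⟨
      𝟙 (i ≟ j) * fibre p q (suc k) one + Σ[ allFin n ] (λ x → w x i * fibre p q k (root x j)) ∎

-- Summation of the recurrence over the choices at the other vertices

module ForestRecurrence {c ℓ} (R : CommutativeSemiring c ℓ) {m}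
                        (w : Fin (suc m) → Fin (suc m) → CommutativeSemiring.Carrier R) where
  open CommutativeSemiring R
  open Indicators R
  open ForestSums R w
  open import Relation.Binary.Reasoning.Setoid setoid

  private
    N : ℕ
    N = suc m

    root : Fin N → Fin N → ParentMap N → Carrier
    root x j p = 𝟙 (root? p x j)

    one : ParentMap N → Carrier
    one _ = 1#

    xs : List (Vec (Maybe (Fin N)) m)
    xs = allVecs (parentOptions N) m

  module _ (i : Fin N) where
    private
      p : Vec (Maybe (Fin N)) m → ParentMap N
      p r = lookup (insertAt r i nothing)

      q : Vec (Maybe (Fin N)) m → Fin N → ParentMap N
      q r y = lookup (insertAt r i (just y))

      pi : ∀ r → p r i ≡ nothing
      pi r = insertAt-lookup r i nothing

      qi : ∀ r y → q r y i ≡ just y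
      qi r y = insertAt-lookup r i (just y)

      agree : ∀ r y x → x ≢ i → q r y x ≡ p r x
      agree r y x = lookup-insertAt-≢ r (just y) nothing

      -- `r` records the parents of all vertices other than `i`. The options for `i` start with
      -- `nothing`, which supplies the base term of the fibre; the `just` options supply the grafts.
      fibred : ∀ k h → forestSum k h ≈ Σ[ xs ] (λ r → fibre (p r) (q r) k h)
      fibred k h = trans (Σ-allVecs (parentOptions N) m i (term k h ∘ lookup))
        (Σ-cong xs λ r → +-congˡ (reflexive (Σ-map just (allFin N) (term k h ∘ lookup ∘ insertAt r i))))

    forestSum-root-zero : ∀ j → forestSum 0 (root i j) ≈ 𝟙 (i ≟ j) * forestSum 0 one
    forestSum-root-zero j = begin
      forestSum 0 (root i j)
        ≈⟨ fibred 0 (root i j) ⟩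
      Σ[ xs ] (λ r → fibre (p r) (q r) 0 (root i j))
        ≈⟨ Σ-cong xs (λ r → fibre-zero (p r) (q r) (pi r) (qi r) (agree r) j) ⟩
      Σ[ xs ] (λ r → 𝟙 (i ≟ j) * fibre (p r) (q r) 0 one)
        ≈⟨ Σ-*ˡ xs (𝟙 (i ≟ j)) (λ r → fibre (p r) (q r) 0 one) ⟩
      𝟙 (i ≟ j) * Σ[ xs ] (λ r → fibre (p r) (q r) 0 one)
        ≈⟨ *-congˡ (fibred 0 one) ⟨
      𝟙 (i ≟ j) * forestSum 0 one ∎

    forestSum-root-suc : ∀ k j →
      forestSum (suc k) (root i j) + Σ[ allFin N ] (λ x → w x i) * forestSum k (root i j) ≈
      𝟙 (i ≟ j) * forestSum (suc k) one + Σ[ allFin N ] (λ x → w x i * forestSum k (root x j))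
    forestSum-root-suc k j = begin
      forestSum (suc k) (root i j) + E * forestSum k (root i j)
        ≈⟨ +-cong (fibred (suc k) (root i j)) (trans (*-congˡ (fibred k (root i j))) (sym (Σ-*ˡ xs E (F k (root i j))))) ⟩
      Σ[ xs ] (F (suc k) (root i j)) + Σ[ xs ] (λ r → E * F k (root i j) r)
        ≈⟨ Σ-+ xs (F (suc k) (root i j)) (λ r → E * F k (root i j) r) ⟨
      Σ[ xs ] (λ r → F (suc k) (root i j) r + E * F k (root i j) r)
        ≈⟨ Σ-cong xs (λ r → fibre-suc (p r) (q r) (pi r) (qi r) (agree r) k j) ⟩
      Σ[ xs ] (λ r → 𝟙 (i ≟ j) * F (suc k) one r + Σ[ allFin N ] (λ x → w x i * F k (root x j) r))
        ≈⟨ Σ-+ xs (λ r → 𝟙 (i ≟ j) * F (suc k) one r) (λ r → Σ[ allFin N ] (λ x → w x i * F k (root x j) r)) ⟩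
      Σ[ xs ] (λ r → 𝟙 (i ≟ j) * F (suc k) one r) + Σ[ xs ] (λ r → Σ[ allFin N ] (λ x → w x i * F k (root x j) r))
        ≈⟨ +-cong (Σ-*ˡ xs (𝟙 (i ≟ j)) (F (suc k) one)) (Σ-swap xs (allFin N) (λ r x → w x i * F k (root x j) r)) ⟩
      𝟙 (i ≟ j) * Σ[ xs ] (F (suc k) one) + Σ[ allFin N ] (λ x → Σ[ xs ] (λ r → w x i * F k (root x j) r))
        ≈⟨ +-cong (*-congˡ (fibred (suc k) one))
             (Σ-cong (allFin N) λ x → trans (*-congˡ (fibred k (root x j))) (sym (Σ-*ˡ xs (w x i) (F k (root x j))))) ⟨
      𝟙 (i ≟ j) * forestSum (suc k) one + Σ[ allFin N ] (λ x → w x i * forestSum k (root x j)) ∎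
      where
      E : Carrier
      E = Σ[ allFin N ] (λ x → w x i)
      F : ℕ → (ParentMap N → Carrier) → Vec (Maybe (Fin N)) m → Carrier
      F k h r = fibre (p r) (q r) k h

-- Out forests as parent maps

∈-allVecs : ∀ {a} {A : Set a} {xs : List A} → (∀ x → x ∈ˡ xs) → ∀ {m} (v : Vec A m) → v ∈ˡ allVecs xs m
∈-allVecs all []      = here ≡.refl
∈-allVecs all (x ∷ v) = ∈-cartesianProductWith⁺ _∷_ (all x) (∈-allVecs all v)

allVecs-unique : ∀ {a} {A : Set a} {xs : List A} → Unique xs → ∀ m → Unique (allVecs xs m)
allVecs-unique u zero    = [] ∷ []
allVecs-unique u (suc m) = Unique.cartesianProductWith⁺ _∷_ ∷-injective u (allVecs-unique u m)

∈-allDigraphs : ∀ {n} (H : Digraph n) → H ∈ˡ allDigraphs n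
∈-allDigraphs = ∈-allVecs (∈-allVecs λ { true → here ≡.refl ; false → there (here ≡.refl) })

allDigraphs-unique : ∀ n → Unique (allDigraphs n)
allDigraphs-unique n = allVecs-unique (allVecs-unique (((λ ()) ∷ []) ∷ [] ∷ []) n) n

∈-allParents : ∀ {n} (v : Vec (Maybe (Fin n)) n) → v ∈ˡ allParents n
∈-allParents = ∈-allVecs λ { nothing → here ≡.refl ; (just x) → there (∈-map⁺ just (∈-allFin x)) }

allParents-unique : ∀ n → Unique (allParents n)
allParents-unique n = allVecs-unique (nothing≢ (allFin n) ∷ Unique.map⁺ Maybe.just-injective (Unique.allFin⁺ n)) n
  where
  nothing≢ : ∀ {a} {A : Set a} (xs : List A) → All (nothing ≢_) (map just xs)
  nothing≢ []       = []
  nothing≢ (x ∷ xs) = (λ ()) ∷ nothing≢ xs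

-- Lists without repetitions are permutations of each other as soon as they have the same members.
-- Preimages under `f` are asked for only where `P` holds, since not every digraph comes from a
-- parent map.
filter-↭ : ∀ {a p} {A B : Set a} {P : A → Set p} (P? : ∀ x → Dec (P x)) {xs : List A} {ys : List B}
  (f : B → A) → (∀ {x y} → f x ≡ f y → x ≡ y) → (∀ x → P x → ∃[ y ] f y ≡ x) →
  Unique xs → Unique ys → (∀ x → x ∈ˡ xs) → (∀ y → y ∈ˡ ys) →
  filter P? xs ↭ map f (filter (P? ∘ f) ys)
filter-↭ {P = P} P? {xs} {ys} f inj section ux uy cx cy = ∼bag⇒↭ (unique∧set⇒bag
  (Unique.filter⁺ P? ux) (Unique.map⁺ inj (Unique.filter⁺ (P? ∘ f) uy)) (mk⇔ to from))
  where
  to : ∀ {x} → x ∈ˡ filter P? xs → x ∈ˡ map f (filter (P? ∘ f) ys)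
  to {x} m with _ , px ← ∈-filter⁻ P? {xs = xs} m | y , ≡.refl ← section x (proj₂ (∈-filter⁻ P? {xs = xs} m)) =
    ∈-map⁺ f (∈-filter⁺ (P? ∘ f) (cy y) px)
  from : ∀ {x} → x ∈ˡ map f (filter (P? ∘ f) ys) → x ∈ˡ filter P? xs
  from m with y , my , ≡.refl ← ∈-map⁻ f m = ∈-filter⁺ P? (cx _) (proj₂ (∈-filter⁻ (P? ∘ f) {xs = ys} my))

outForests-↭ : ∀ {n} (G : Digraph n) k → outForests G k ↭
  map (toDigraph ∘ lookup)
      (filter (λ v → let H = toDigraph (lookup v) in isOutForest? G H ×-dec (length (arcs H) ℕ.≟ k))
              (allParents n))
outForests-↭ {n} G k = filter-↭ (λ H → isOutForest? G H ×-dec (length (arcs H) ℕ.≟ k)) (toDigraph ∘ lookup)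
  (λ {u v} eq → ≡.trans (≡.sym (tabulate∘lookup u))
    (≡.trans (tabulate-cong (toDigraph-injective (lookup u) (lookup v) eq)) (tabulate∘lookup v)))
  (λ H ((_ , _ , in≤1) , _) → Vec.tabulate (fromDigraph H) ,
    ≡.trans (toDigraph-cong _ (fromDigraph H) (lookup∘tabulate (fromDigraph H))) (toDigraph-fromDigraph H in≤1))
  (allDigraphs-unique n) (allParents-unique n) ∈-allDigraphs ∈-allParents
  where
  toDigraph-cong : ∀ (p q : ParentMap n) → (∀ b → p b ≡ q b) → toDigraph p ≡ toDigraph q
  toDigraph-cong p q p≗q = tabulate-cong λ a → tabulate-cong λ b → ≡.cong (λ v → does (v ≟ᴹ just a)) (p≗q b)

module _ {c ℓ₁ ℓ₂ ℓ₃} {K : OrderedField c ℓ₁ ℓ₂ ℓ₃} {n} (Γ : WeightedDigraph K n) where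
  open WeightedDigraph Γ using (graph; weight; loopless; no-arc)
  private R = OrderedField.commutativeRing K
  open CommutativeRing R
  open import Algebra.Properties.Ring ring using (-0#≈0#; -‿involutive; -1*x≈-x)
  open Matrices R using (-ᴹ_)
  open Indicators commutativeSemiring
  open ForestSums commutativeSemiring weight
  open import Relation.Binary.Reasoning.Setoid setoid

  subgraphWeight-toDigraph : ∀ (p : ParentMap n) → subgraphWeight Γ (toDigraph p) ≈ weightOf p
  subgraphWeight-toDigraph p = ⨁-arcs *-commutativeMonoid p (uncurry weight)

  isOutForest⇔ : ∀ (p : ParentMap n) k → toDigraph p ⊆ᴳ graph →
    (IsOutForest graph (toDigraph p) × length (arcs (toDigraph p)) ≡ k) ⇔ (NoCycle p × #arcs p ≡ k)
  isOutForest⇔ p k sub = mk⇔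
    (λ ((_ , ac , _) , eq) → Equivalence.to (acyclic⇔noCycle p) ac , ≡.trans (≡.sym (length-arcs p)) eq)
    (λ (nc , eq) → (sub , Equivalence.from (acyclic⇔noCycle p) nc , indegree≤1 p) , ≡.trans (length-arcs p) eq)

  -- Parent maps using a pair outside Γ have weight 0, so the condition of
  -- being a subgraph of Γ can be dropped.
  outForest-term : ∀ k (p : ParentMap n) y →
    𝟙 (isOutForest? graph (toDigraph p) ×-dec (length (arcs (toDigraph p)) ℕ.≟ k)) * (y * subgraphWeight Γ (toDigraph p)) ≈
    𝟙 (noCycle? p) * 𝟙 (#arcs p ℕ.≟ k) * weightOf p * y
  outForest-term k p y = trans (*-congˡ (trans (*-comm _ _) (*-congʳ (subgraphWeight-toDigraph p))))
    (trans (sym (*-assoc _ _ _)) (*-congʳ main))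
    where
    F? = isOutForest? graph (toDigraph p) ×-dec (length (arcs (toDigraph p)) ℕ.≟ k)
    main : 𝟙 F? * weightOf p ≈ 𝟙 (noCycle? p) * 𝟙 (#arcs p ℕ.≟ k) * weightOf p
    main with any? (λ b → any? λ a → parent? p b a ×-dec ¬? (arc? graph a b))
    ... | yes (b , a , s , ¬arc) = trans (trans (*-congˡ W≈0) (zeroʳ _)) (sym (trans (*-congˡ W≈0) (zeroʳ _)))
      where
      W≈0 : weightOf p ≈ 0#
      W≈0 = Π-zero (λ b → maybe (λ a → weight a b) 1# (p b)) (∈-allFin b)
        (trans (reflexive (≡.cong (maybe (λ a → weight a b) 1#) s)) (no-arc ¬arc))
    ... | no none = *-congʳ (trans
        (reflexive (𝟙-⇔ (isOutForest⇔ p k sub) F? (noCycle? p ×-dec (#arcs p ℕ.≟ k))))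
        (𝟙-× (noCycle? p) (#arcs p ℕ.≟ k)))
      where
      sub : toDigraph p ⊆ᴳ graph
      sub a b arc = decidable-stable (arc? graph a b) λ ¬arc →
        none (b , a , Equivalence.to (arc⇔parent p) arc , ¬arc)

  -- One reindexing serves both quantities: `h` is 1 for `σ` and the indicator of `InTreeFrom` for
  -- `Q`.
  outForests-sum : ∀ k (h : Digraph n → Carrier) →
    Σ[ outForests graph k ] (λ H → h H * subgraphWeight Γ H) ≈ forestSum k (h ∘ toDigraph)
  outForests-sum k h = begin
    Σ[ outForests graph k ] f
      ≈⟨ Σ-↭ f (outForests-↭ graph k) ⟩
    Σ[ map D (filter (F? ∘ D) (allParents n)) ] f
      ≡⟨ Σ-map D (filter (F? ∘ D) (allParents n)) f ⟩
    Σ[ filter (F? ∘ D) (allParents n) ] (f ∘ D)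
      ≈⟨ Σ-filter-𝟙 (F? ∘ D) (allParents n) (f ∘ D) ⟩
    Σ[ allParents n ] (λ v → 𝟙 (F? (D v)) * f (D v))
      ≈⟨ Σ-cong (allParents n) (λ v → outForest-term k (lookup v) (h (D v))) ⟩
    forestSum k (h ∘ toDigraph) ∎
    where
    D : Vec (Maybe (Fin n)) n → Digraph n
    D = toDigraph ∘ lookup
    F? : ∀ H → Dec (IsOutForest graph H × length (arcs H) ≡ k)
    F? H = isOutForest? graph H ×-dec (length (arcs H) ℕ.≟ k)
    f : Digraph n → Carrier
    f H = h H * subgraphWeight Γ H

  σ-forestSum : ∀ k → σ Γ k ≈ forestSum k (λ _ → 1#)
  σ-forestSum k = trans (Σ-cong (outForests graph k) λ H → sym (*-identityˡ (subgraphWeight Γ H)))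
    (outForests-sum k (λ _ → 1#))

  Q-forestSum : ∀ k i j → Q Γ k i j ≈ forestSum k (λ p → 𝟙 (root? p i j))
  Q-forestSum k i j = begin
    Q Γ k i j
      ≈⟨ Σ-filter-𝟙 (λ H → inTreeFrom? H j i) (outForests graph k) (subgraphWeight Γ) ⟩
    Σ[ outForests graph k ] (λ H → 𝟙 (inTreeFrom? H j i) * subgraphWeight Γ H)
      ≈⟨ outForests-sum k (λ H → 𝟙 (inTreeFrom? H j i)) ⟩
    forestSum k (λ p → 𝟙 (inTreeFrom? (toDigraph p) j i))
      ≈⟨ Σ-cong (allParents n) (λ v → *-congˡ (reflexive
           (𝟙-⇔ (inTreeFrom⇔root (lookup v) j i) (inTreeFrom? (toDigraph (lookup v)) j i) (root? (lookup v) i j)))) ⟩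
    forestSum k (λ p → 𝟙 (root? p i j)) ∎

  -- The Kirchhoff matrix in terms of the arc weights

  inWeight : Fin n → Carrier
  inWeight i = Σ[ allFin n ] (λ x → weight x i)

  weight-loop : ∀ i → weight i i ≈ 0#
  weight-loop i = no-arc (loopless i)

  Σ-neg : ∀ {a} {A : Set a} (xs : List A) (f : A → Carrier) → Σ[ xs ] (λ x → - f x) ≈ - Σ[ xs ] f
  Σ-neg xs f = trans (Σ-cong xs (λ x → sym (-1*x≈-x (f x)))) (trans (Σ-*ˡ xs (- 1#) f) (-1*x≈-x _))

  -- -L is the transposed weight matrix minus the diagonal of in-weights. Loops have weight 0, so
  -- the sum may run over all vertices and the weight matrix adds nothing on the diagonal.
  -kirchhoff-entry : ∀ i x → (-ᴹ kirchhoff Γ) i x ≈ weight x i + 𝟙 (i ≟ x) * - inWeight i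
  -kirchhoff-entry i x with i ≟ x
  ... | no i≢x = begin
    - - weight x i                ≈⟨ -‿involutive _ ⟩
    weight x i                    ≈⟨ trans (+-congˡ (zeroˡ _)) (+-identityʳ _) ⟨
    weight x i + 0# * - inWeight i ∎
  ... | yes ≡.refl = begin
    - - Σ[ filter (λ k → ¬? (k ≟ i)) (allFin n) ] (λ k → - weight k i)
      ≈⟨ -‿involutive _ ⟩
    Σ[ filter (λ k → ¬? (k ≟ i)) (allFin n) ] (λ k → - weight k i)
      ≈⟨ Σ-filter-𝟙 (λ k → ¬? (k ≟ i)) (allFin n) (λ k → - weight k i) ⟩
    Σ[ allFin n ] (λ k → 𝟙 (¬? (k ≟ i)) * - weight k i)
      ≈⟨ Σ-cong (allFin n) off-diagonal ⟩
    Σ[ allFin n ] (λ k → - weight k i)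
      ≈⟨ Σ-neg (allFin n) (λ k → weight k i) ⟩
    - inWeight i
      ≈⟨ trans (+-cong (weight-loop i) (*-identityˡ _)) (+-identityˡ _) ⟨
    weight i i + 1# * - inWeight i ∎
    where
    off-diagonal : ∀ k → 𝟙 (¬? (k ≟ i)) * - weight k i ≈ - weight k i
    off-diagonal k with k ≟ i
    ... | no  _      = *-identityˡ _
    ... | yes ≡.refl = trans (zeroˡ _) (sym (trans (-‿cong (weight-loop i)) -0#≈0#))

  -kirchhoff-row : ∀ i (y : Fin n → Carrier) →
    Σ[ allFin n ] (λ x → (-ᴹ kirchhoff Γ) i x * y x) + inWeight i * y i ≈ Σ[ allFin n ] (λ x → weight x i * y x)
  -kirchhoff-row i y = begin
    Σ[ allFin n ] (λ x → (-ᴹ kirchhoff Γ) i x * y x) + inWeight i * y i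
      ≈⟨ +-congʳ (Σ-cong (allFin n) λ x → trans (*-congʳ (-kirchhoff-entry i x)) (distribʳ (y x) _ _)) ⟩
    Σ[ allFin n ] (λ x → weight x i * y x + 𝟙 (i ≟ x) * - inWeight i * y x) + inWeight i * y i
      ≈⟨ +-congʳ (Σ-+ (allFin n) (λ x → weight x i * y x) (λ x → 𝟙 (i ≟ x) * - inWeight i * y x)) ⟩
    (Y + Σ[ allFin n ] (λ x → 𝟙 (i ≟ x) * - inWeight i * y x)) + inWeight i * y i
      ≈⟨ +-congʳ (+-congˡ diagonal) ⟩
    (Y + - inWeight i * y i) + inWeight i * y i
      ≈⟨ +-assoc _ _ _ ⟩
    Y + (- inWeight i * y i + inWeight i * y i)
      ≈⟨ +-congˡ (trans (sym (distribʳ (y i) _ _)) (trans (*-congʳ (-‿inverseˡ _)) (zeroˡ _))) ⟩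
    Y + 0#
      ≈⟨ +-identityʳ Y ⟩
    Y ∎
    where
    Y : Carrier
    Y = Σ[ allFin n ] (λ x → weight x i * y x)
    diagonal : Σ[ allFin n ] (λ x → 𝟙 (i ≟ x) * - inWeight i * y x) ≈ - inWeight i * y i
    diagonal = trans
      (Σ-only i (λ x → 𝟙 (i ≟ x) * - inWeight i * y x) λ x x≢i →
        trans (*-congʳ (trans (*-congʳ (reflexive (𝟙-false (i ≟ x) (x≢i ∘ ≡.sym)))) (zeroˡ _))) (zeroˡ _))
      (*-congʳ (trans (*-congʳ (reflexive (𝟙-true (i ≟ i) ≡.refl))) (*-identityˡ _)))

-- The matrix recurrence and its solution

module _ {c ℓ₁ ℓ₂ ℓ₃} {K : OrderedField c ℓ₁ ℓ₂ ℓ₃} {m} (Γ : WeightedDigraph K (suc m)) where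
  open WeightedDigraph Γ using (weight)
  private
    R = OrderedField.commutativeRing K
    N = suc m
  open CommutativeRing R
  open import Algebra.Properties.Ring ring using (+-cancelʳ)
  open Matrices R using (_*ᴹ_; -ᴹ_; _^ᴹ_; 1ᴹ; sum-syntax; sum⁺-syntax)
  open Indicators commutativeSemiring
  open ForestSums commutativeSemiring weight
  open ForestRecurrence commutativeSemiring weight
  open import Algebra.Properties.Semiring.Sum semiring using (∑-comm; *-distribˡ-sum; sum-cong-≋)
  open import Relation.Binary.Reasoning.Setoid setoid

  Q-zero : ∀ i j → Q Γ 0 i j ≈ σ Γ 0 * 1ᴹ i j
  Q-zero i j = begin
    Q Γ 0 i j                                ≈⟨ Q-forestSum Γ 0 i j ⟩
    forestSum 0 (λ p → 𝟙 (root? p i j))      ≈⟨ forestSum-root-zero i j ⟩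
    𝟙 (i ≟ j) * forestSum 0 (λ _ → 1#)       ≈⟨ *-comm _ _ ⟩
    forestSum 0 (λ _ → 1#) * 1ᴹ i j          ≈⟨ *-congʳ (σ-forestSum Γ 0) ⟨
    σ Γ 0 * 1ᴹ i j                           ∎

  -- The subtraction-free recurrence and `-kirchhoff-row` carry the same in-weight term, which
  -- cancels in the ring.
  Q-suc : ∀ k i j → Q Γ (suc k) i j ≈ σ Γ (suc k) * 1ᴹ i j + ((-ᴹ kirchhoff Γ) *ᴹ Q Γ k) i j
  Q-suc k i j = +-cancelʳ (inWeight Γ i * Q Γ k i j) _ _ (begin
    Q Γ (suc k) i j + inWeight Γ i * Q Γ k i j
      ≈⟨ +-cong (Q-forestSum Γ (suc k) i j) (*-congˡ (Q-forestSum Γ k i j)) ⟩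
    forestSum (suc k) (λ p → 𝟙 (root? p i j)) + inWeight Γ i * forestSum k (λ p → 𝟙 (root? p i j))
      ≈⟨ forestSum-root-suc i k j ⟩
    𝟙 (i ≟ j) * forestSum (suc k) (λ _ → 1#) + Σ[ allFin N ] (λ x → weight x i * forestSum k (λ p → 𝟙 (root? p x j)))
      ≈⟨ +-cong (trans (*-comm _ _) (*-congʳ (sym (σ-forestSum Γ (suc k)))))
                (Σ-cong (allFin N) λ x → *-congˡ (sym (Q-forestSum Γ k x j))) ⟩
    σ Γ (suc k) * 1ᴹ i j + Σ[ allFin N ] (λ x → weight x i * Q Γ k x j)
      ≈⟨ +-congˡ (-kirchhoff-row Γ i (λ x → Q Γ k x j)) ⟨
    σ Γ (suc k) * 1ᴹ i j + (Σ[ allFin N ] (λ x → (-ᴹ kirchhoff Γ) i x * Q Γ k x j) + inWeight Γ i * Q Γ k i j)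
      ≈⟨ +-assoc _ _ _ ⟨
    σ Γ (suc k) * 1ᴹ i j + Σ[ allFin N ] (λ x → (-ᴹ kirchhoff Γ) i x * Q Γ k x j) + inWeight Γ i * Q Γ k i j
      ≡⟨ ≡.cong (λ z → σ Γ (suc k) * 1ᴹ i j + z + inWeight Γ i * Q Γ k i j)
                (Σ-allFin N (λ x → (-ᴹ kirchhoff Γ) i x * Q Γ k x j)) ⟩
    σ Γ (suc k) * 1ᴹ i j + ((-ᴹ kirchhoff Γ) *ᴹ Q Γ k) i j + inWeight Γ i * Q Γ k i j ∎)

  Q-expansion : ∀ k i j → Q Γ k i j ≈ ∑[ l ≤ k ] (σ Γ (k ∸ toℕ l) * ((-ᴹ kirchhoff Γ) ^ᴹ toℕ l) i j)
  Q-expansion zero    i j = trans (Q-zero i j) (sym (+-identityʳ _))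
  -- The `σ (suc k)` term is the summand `l = 0`. The others are indexed by `suc l`, where
  -- `suc k ∸ suc l` computes to `k ∸ l`, so they form `M` times the expansion for `k`, with the
  -- extra factor `M` absorbed into the power.
  Q-expansion (suc k) i j = trans (Q-suc k i j) (+-congˡ (begin
    ∑[ x < N ] (M i x * Q Γ k x j)
      ≈⟨ sum-cong-≋ {N} (λ x → *-congˡ {M i x} (Q-expansion k x j)) ⟩
    ∑[ x < N ] (M i x * ∑[ l ≤ k ] (σ Γ (k ∸ toℕ l) * (M ^ᴹ toℕ l) x j))
      ≈⟨ sum-cong-≋ {N} (λ x → *-distribˡ-sum (M i x) (λ (l : Fin (suc k)) → σ Γ (k ∸ toℕ l) * (M ^ᴹ toℕ l) x j)) ⟩
    ∑[ x < N ] ∑[ l ≤ k ] (M i x * (σ Γ (k ∸ toℕ l) * (M ^ᴹ toℕ l) x j))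
      ≈⟨ ∑-comm {N} {suc k} (λ x l → M i x * (σ Γ (k ∸ toℕ l) * (M ^ᴹ toℕ l) x j)) ⟩
    ∑[ l ≤ k ] ∑[ x < N ] (M i x * (σ Γ (k ∸ toℕ l) * (M ^ᴹ toℕ l) x j))
      ≈⟨ sum-cong-≋ {suc k} (λ l → sum-cong-≋ {N} (λ x → x*yz≈y*xz (M i x) (σ Γ (k ∸ toℕ l)) ((M ^ᴹ toℕ l) x j))) ⟩
    ∑[ l ≤ k ] ∑[ x < N ] (σ Γ (k ∸ toℕ l) * (M i x * (M ^ᴹ toℕ l) x j))
      ≈⟨ sum-cong-≋ {suc k} (λ l → *-distribˡ-sum (σ Γ (k ∸ toℕ l)) (λ (x : Fin N) → M i x * (M ^ᴹ toℕ l) x j)) ⟨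
    ∑[ l ≤ k ] (σ Γ (k ∸ toℕ l) * (M ^ᴹ suc (toℕ l)) i j) ∎))
    where
    M = -ᴹ kirchhoff Γ
    open import Algebra.Properties.CommutativeSemigroup *-commutativeSemigroup
      using () renaming (x∙yz≈y∙xz to x*yz≈y*xz)

theorem7 : ∀ {c ℓ₁ ℓ₂ ℓ₃} (K : OrderedField c ℓ₁ ℓ₂ ℓ₃) →
    let open OrderedField K hiding (_<_)
        open Matrices commutativeRing
    in ∀ (n : ℕ) → 1 < n → (Γ : WeightedDigraph K n) →
       ∀ (v : ℕ) → IsOutForestDimension (WeightedDigraph.graph Γ) v →
       ∀ (k : ℕ) → k ≤ n ∸ v → ∀ (i j : Fin n) →
       Q Γ k i j ≈ ∑[ m ≤ k ] (σ Γ (k ∸ toℕ m) * ((-ᴹ kirchhoff Γ) ^ᴹ toℕ m) i j)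
theorem7 K (suc _) _ Γ _ _ k _ = Q-expansion Γ k
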